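{- Let $G$ be a complete graph on $n$ vertices whose edges are labeled ``$+$'' or ``$-$''. For any $Q>0$, Algorithm $\textsc{QECC}$ run on $G$ with query budget $Q$ makes at most $Q$ edge queries and outputs a clustering of $G$ whose expected cost is at most $3\cdot \mathrm{OPT} + \frac{n^3}{2Q}$, where $\mathrm{OPT}$ is the minimum cost of a clustering of $G$. It runs in time $O(Q)$ assuming unit-cost queries.
   Context: Correlation clustering: the input is a vertex set $V=[n]$ and a complete graph on $V$ whose edges are labeled ``$+$'' (similar) or ``$-$'' (dissimilar); equivalently a symmetric function $s:\binom{V}{2}\to\{0,1\}$ with $s(x,y)=1$ iff $\{x,y\}$ is a ``$+$'' edge. A clustering is a function $\ell:V\to\mathbb{N}$; its cost is the number of disagreements, $\mathrm{cost}(\ell)=\sum_{\{x,y\}:\ell(x)=\ell(y)}(1-s(x,y))+\sum_{\{x,y\}:\ell(x)\ne\ell(y)}s(x,y)$, and $\mathrm{OPT}$ is the minimum cost over all clusterings. The algorithm does not see $s$ directly; it may query a pair $(x,y)$ to learn $s(x,y)$, each such query counting as one query. For $v\in V$, $\Gamma^+(v)$ denotes the set of vertices joined to $v$ by a ``$+$'' edge. Algorithm $\textsc{QECC}$ (input: query access to $G$, budget $Q$): set $R\gets V$. While $R\neq\emptyset$ and $Q\ge |R|-1$: pick a pivot $v$ uniformly at random from $R$; query all pairs $(v,w)$ for $w\in R\setminus\{v\}$ to determine $\Gamma^+(v)\cap R$; set $Q\gets Q-|R|+1$; output the cluster $C=\{v\}\cup(\Gamma^+(v)\cap R)$; set $R\gets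 R\setminus C$. After the loop, output a separate singleton cluster for each remaining $v\in R$.
   Formalization: For the O(Q) time claim, V is given at no charge and the vertices left after the loop are output as one uncharged set, read as singletons: writing n singletons when Q < n−1 would not take O(Q) time. The budget Q is a positive integer. -}

module Defs where

open import Data.Bool.Base using (Bool; true; false; not; if_then_else_)
open import Data.Fin.Base as Fin using (Fin; zero; suc; toℕ)
import Data.Fin.Properties as Fin
open import Data.Integer.Base using (+_)
open import Data.List.Base
  using (List; []; _∷_; [_]; _++_; map; filter; concat; length; lookup; removeAt; allFin; cartesianProduct)
import Data.List.Membership.DecPropositional as DecMembership
open import Data.List.Properties using (filter-≐)
open import Data.List.Relation.Binary.Permutation.Propositional using (_↭_)
open import Data.List.Relation.Unary.All using (All)
open import Data.Nat.Base using (ℕ; zero; suc; pred; _+_; _∸_; _≤_; NonZero)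
open import Data.Nat.ListAction using (sum)
open import Data.Nat.Properties using (_≟_; _≤?_; ≤-refl; ≤-trans; ≤-total; ≤-reflexive)
open import Data.Product.Base using (∃; _×_; _,_; proj₁; proj₂; uncurry)
open import Data.Rational.Base as ℚ using (ℚ; _/_)
import Data.Rational.Properties as ℚ
open import Data.Sum.Base using (inj₁; inj₂)
open import Data.Vec.Base as Vec using (Vec; []; _∷_; tabulate)
open import Data.Vec.Properties using (lookup∘tabulate)
open import Function.Base using (_∘_)
open import Relation.Binary.PropositionalEquality
  using (_≡_; _≢_; refl; sym; trans; cong; cong₂)
open import Relation.Nullary using (Dec; yes; no; does; ¬?; contradiction)

import Algebra.Properties.CommutativeMonoid.Sum ℚ.+-0-commutativeMonoid as ℚSum

------------------------------------------------------------------------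
-- Correlation clustering

-- `similar x y ≡ true` iff {x,y} is a "+" edge.  Diagonal values carry no
-- meaning: neither the cost nor the algorithm ever looks at them.
record LabelledGraph (n : ℕ) : Set where
  field
    similar   : Fin n → Fin n → Bool
    symmetric : ∀ x y → similar x y ≡ similar y x

open LabelledGraph public

s : ∀ {n} → LabelledGraph n → Fin n × Fin n → ℕ
s G (x , y) = if similar G x y then 1 else 0

-- The unordered pair {x,y} is represented by (x , y) with x < y.
pairs : ∀ n → List (Fin n × Fin n)
pairs n = filter (uncurry Fin._<?_) (cartesianProduct (allFin n) (allFin n))

Together : ∀ {n} → (Fin n → ℕ) → Fin n × Fin n → Set
Together ℓ (x , y) = ℓ x ≡ ℓ y

together? : ∀ {n} (ℓ : Fin n → ℕ) p → Dec (Together ℓ p)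
together? ℓ (x , y) = ℓ x ≟ ℓ y

cost : ∀ {n} → LabelledGraph n → (Fin n → ℕ) → ℕ
cost {n} G ℓ =
    sum (map (λ p → 1 ∸ s G p) (filter (together? ℓ) (pairs n)))
  + sum (map (s G) (filter (¬? ∘ together? ℓ) (pairs n)))

IsMinimumCost : ∀ {n} → LabelledGraph n → ℕ → Set
IsMinimumCost G k = (∃ λ ℓ → cost G ℓ ≡ k) × (∀ ℓ → k ≤ cost G ℓ)

-- The minimum exists: the cost depends only on the partition induced by ℓ,
-- so it is enough to minimise over labels 0, …, n.

cost-cong : ∀ {n} (G : LabelledGraph n) {ℓ ℓ′ : Fin n → ℕ} →
            (∀ x y → ℓ x ≡ ℓ y → ℓ′ x ≡ ℓ′ y) →
            (∀ x y → ℓ′ x ≡ ℓ′ y → ℓ x ≡ ℓ y) →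
            cost G ℓ ≡ cost G ℓ′
cost-cong {n} G {ℓ} {ℓ′} f g = cong₂ _+_
  (cong (sum ∘ map (λ p → 1 ∸ s G p))
    (filter-≐ (together? ℓ) (together? ℓ′)
      ((λ {p} → f (proj₁ p) (proj₂ p)) , (λ {p} → g (proj₁ p) (proj₂ p)))
      (pairs n)))
  (cong (sum ∘ map (s G))
    (filter-≐ (¬? ∘ together? ℓ) (¬? ∘ together? ℓ′)
      ((λ {p} ¬t t → ¬t (g (proj₁ p) (proj₂ p) t)) ,
       (λ {p} ¬t t → ¬t (f (proj₁ p) (proj₂ p) t)))
      (pairs n)))

argminFin : ∀ {k} (F : Fin (suc k) → ℕ) → ∃ λ i → ∀ j → F i ≤ F j
argminFin {zero}  F = zero , λ { zero → ≤-refl }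
argminFin {suc k} F with argminFin (F ∘ suc)
... | i , min with ≤-total (F zero) (F (suc i))
...   | inj₁ le = zero  , λ { zero → ≤-refl ; (suc j) → ≤-trans le (min j) }
...   | inj₂ ge = suc i , λ { zero → ge ; (suc j) → min j }

argminVec : ∀ {k} m (F : Vec (Fin (suc k)) m → ℕ) → ∃ λ u → ∀ w → F u ≤ F w
argminVec zero    F = [] , λ { [] → ≤-refl }
argminVec (suc m) F =
  let tailMin = λ a → argminVec m (λ u → F (a ∷ u))
      a , aMin = argminFin (λ b → F (b ∷ proj₁ (tailMin b)))
  in a ∷ proj₁ (tailMin a) ,
     λ { (b ∷ w) → ≤-trans (aMin b) (proj₂ (tailMin b) w) }

relabel : ∀ {n} → (Fin n → ℕ) → ℕ → Fin (suc n)
relabel ℓ a with Fin.any? (λ x → ℓ x ≟ a)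
... | yes (x , _) = suc x
... | no  _       = zero

relabel-injective : ∀ {n} (ℓ : Fin n → ℕ) x y →
                    relabel ℓ (ℓ x) ≡ relabel ℓ (ℓ y) → ℓ x ≡ ℓ y
relabel-injective ℓ x y eq
  with Fin.any? (λ z → ℓ z ≟ ℓ x) | Fin.any? (λ z → ℓ z ≟ ℓ y)
... | yes (u , p) | yes (v , q) = trans (sym p) (trans (cong ℓ (Fin.suc-injective eq)) q)
... | no ¬p       | _           = contradiction (x , refl) ¬p
... | _           | no ¬q       = contradiction (y , refl) ¬q

minimumCost : ∀ {n} (G : LabelledGraph n) → ∃ (IsMinimumCost G)
minimumCost {n} G = F u , (toℕ ∘ Vec.lookup u , refl) , λ ℓ →
  ≤-trans (uMin (tabulate (relabel ℓ ∘ ℓ))) (≤-reflexive (F-relabel ℓ))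
  where
  F : Vec (Fin (suc n)) n → ℕ
  F w = cost G (toℕ ∘ Vec.lookup w)

  u    = proj₁ (argminVec n F)
  uMin = proj₂ (argminVec n F)

  F-relabel : ∀ ℓ → F (tabulate (relabel ℓ ∘ ℓ)) ≡ cost G ℓ
  F-relabel ℓ = cost-cong G
    (λ x y eq → relabel-injective ℓ x y
      (trans (sym (lookup∘tabulate _ x))
        (trans (Fin.toℕ-injective eq) (lookup∘tabulate _ y))))
    (λ x y eq → cong toℕ
      (trans (lookup∘tabulate _ x)
        (trans (cong (relabel ℓ) eq) (sym (lookup∘tabulate _ y)))))

OPT : ∀ {n} → LabelledGraph n → ℕ
OPT G = proj₁ (minimumCost G)

-- Clusterings given as a list of clusters

record IsClustering {n} (𝒞 : List (List (Fin n))) : Set where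
  field
    nonEmpty  : All (_≢ []) 𝒞
    partition : concat 𝒞 ↭ allFin n

-- The label of v is the position of the (first) cluster containing v.
labelling : ∀ {n} → List (List (Fin n)) → Fin n → ℕ
labelling []      v = 0
labelling (C ∷ 𝒞) v = if does (v ∈? C) then 0 else suc (labelling 𝒞 v)
  where open DecMembership Fin._≟_ using (_∈?_)

------------------------------------------------------------------------
-- Randomised query algorithms

-- Programs over the vertex set Fin n with no access to the edge labels other
-- than through `query`.  Each of `query`, `uniform` (a uniformly random
-- element of Fin m) and `step` (any other elementary operation) takes one
-- unit of time.
data Prog (n : ℕ) (A : Set) : Set where
  return  : A → Prog n A
  query   : Fin n → Fin n → (Bool → Prog n A) → Prog n A
  uniform : ∀ m .{{_ : NonZero m}} → (Fin m → Prog n A) → Prog n A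
  step    : Prog n A → Prog n A

infixl 1 _>>=_
_>>=_ : ∀ {n A B} → Prog n A → (A → Prog n B) → Prog n B
return a    >>= f = f a
query x y k >>= f = query x y λ b → k b >>= f
uniform m k >>= f = uniform m λ i → k i >>= f
step p      >>= f = step (p >>= f)

steps : ∀ {n A} → ℕ → Prog n A → Prog n A
steps zero    p = p
steps (suc k) p = step (steps k p)

-- `Run G p a q t`: some execution of p on G (that is, some sequence of random
-- choices) returns a after q queries and t units of time.
data Run {n A} (G : LabelledGraph n) : Prog n A → A → ℕ → ℕ → Set where
  return  : ∀ {a} → Run G (return a) a 0 0
  query   : ∀ {x y k a q t} → Run G (k (similar G x y)) a q t →
            Run G (query x y k) a (suc q) (suc t)
  uniform : ∀ {m} .{{_ : NonZero m}} {k a q t} (i : Fin m) → Run G (k i) a q t →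
            Run G (uniform m k) a q (suc t)
  step    : ∀ {p a q t} → Run G p a q t → Run G (step p) a q (suc t)

-- Expected value of f at the result of p on G.
𝔼 : ∀ {n A} → LabelledGraph n → Prog n A → (A → ℚ) → ℚ
𝔼 G (return a)    f = f a
𝔼 G (query x y k) f = 𝔼 G (k (similar G x y)) f
𝔼 G (uniform m k) f = (+ 1 / m) ℚ.* ℚSum.sum (λ i → 𝔼 G (k i) f)
𝔼 G (step p)      f = 𝔼 G p f

------------------------------------------------------------------------
-- QECC

-- The vertices left over after the loop are handed over as they stand, to be
-- read as singletons.  Writing them out one by one could take about n steps
-- whatever the budget, so it could not be done in time O(Q).
record Output (n : ℕ) : Set where
  constructor output
  field
    clusters   : List (List (Fin n))
    singletons : List (Fin n)

open Output public

clustering : ∀ {n} → Output n → List (List (Fin n))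
clustering out = clusters out ++ map [_] (singletons out)

-- Splits ws into ws ∩ Γ⁺(v) and ws \ Γ⁺(v).
split : ∀ {n} → Fin n → List (Fin n) → Prog n (List (Fin n) × List (Fin n))
split v []       = return ([] , [])
split v (w ∷ ws) =
  query v w λ similar →
  step (split v ws >>= λ (N , rest) →
  return (if similar then (w ∷ N , rest) else (N , w ∷ rest)))

-- The first argument is fuel for structural recursion.  Each round removes
-- the pivot from R, so any fuel ≥ |R| never runs out before R is empty.  The
-- size of R is taken to be stored with it, so the loop test is a single step;
-- finding and removing the pivot is charged |R| steps, and updating the
-- budget and emitting the cluster one step each.
loop : ∀ {n} → ℕ → ℕ → List (Fin n) → Prog n (Output n)
loop zero       Q R  = return (output [] R)
loop (suc fuel) Q [] = step (return (output [] []))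
loop (suc fuel) Q R@(_ ∷ _) =
  step (if does (pred (length R) ≤? Q) then round else return (output [] R))
  where
  round =
    uniform (length R) λ i →
    let v = lookup R i in
    steps (length R) (
    split v (removeAt R i) >>= λ (N , rest) →
    step (
    loop fuel (Q ∸ pred (length R)) rest >>= λ out →
    step (
    return (output ((v ∷ N) ∷ clusters out) (singletons out)))))

QECC : ∀ n → ℕ → Prog n (Output n)
QECC n Q = loop n Q (allFin n)

-- For a fixed clustering ℓ, let e(R) be its cost inside the set R of unsettled
-- vertices.  A pair settled wrongly by a pivot v forms with v a triangle with
-- exactly two "+" edges, and ℓ errs on one of its edges; since every vertex of
-- the triangle has a "+" edge into the opposite one, that edge is settled if
-- the opposite vertex is chosen instead.  Hence a random pivot costs on average
-- at most 3 times the average decrease of e(R).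
--
-- The vertices left at the end cost the "+" pairs among them.  A random pivot
-- of R settles on average at least Σ d² / |R| of the ordered "+" pairs, d being
-- the "+" degrees in R, so the mean number W of such pairs drops by W² / n² per
-- round, hence is at most n² / (k + 1) after k rounds.  The budget pays for
-- k = ⌊Q / n⌋ rounds, and k + 1 ≥ Q / n.

module Submission where

open import Defs
import Algebra.Properties.CommutativeMonoid.Sum as CommutativeMonoidSum
import Algebra.Properties.Semiring.Sum as SemiringSum
open import Algebra.Bundles using (CommutativeRing)
open import Data.Bool.Base using (Bool; true; false; T; not; _∨_; if_then_else_)
open import Data.Fin.Base as Fin using (Fin; zero; suc)
import Data.Fin.Properties as Fin
import Data.Integer.Base as ℤ
import Data.Integer.Properties as ℤ
open import Data.List.Base
  using (List; []; _∷_; [_]; _++_; map; filter; filterᵇ; concat; length; lookup; removeAt; allFin;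
         cartesianProduct)
import Data.List.Membership.DecPropositional as DecMembership
open import Data.List.Membership.Propositional using (_∈_)
open import Data.List.Membership.Propositional.Properties using (∈-lookup; ∈-filter⁺; ∈-filter⁻)
open import Data.List.Properties
  using (length-tabulate; length-filter; length-removeAt; concat-map-[_])
open import Data.List.Relation.Binary.Permutation.Propositional
  using (_↭_; ↭-refl; ↭-reflexive; ↭-sym; ↭-trans; prep; swap)
open import Data.List.Relation.Binary.Permutation.Propositional.Properties
  using (shift; ∈-resp-↭; ++⁺ˡ)
open import Data.List.Relation.Unary.All as All using (All; []; _∷_)
open import Data.List.Relation.Unary.Any using (here; there; tail)
open import Data.List.Relation.Unary.Unique.Propositional using (Unique; []; _∷_)
import Data.List.Relation.Unary.Unique.Propositional.Properties as Unique
open import Data.Nat.Base as ℕ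
  using (ℕ; zero; suc; _+_; _*_; _∸_; _^_; _≤_; _<_; NonZero; z≤n; s≤s)
open import Data.Nat.DivMod using (m/n*n≤m; m≡m%n+[m/n]*n; m%n<n)
open import Data.Nat.ListAction using (sum)
open import Data.Nat.Properties
open import Data.Nat.Tactic.RingSolver using (solve-∀)
open import Data.Product.Base using (∃-syntax; _×_; _,_; proj₁; proj₂; uncurry)
open import Data.Rational.Base as ℚ using (ℚ; _/_; toℚᵘ)
import Data.Rational.Properties as ℚ
import Data.Rational.Unnormalised.Base as ℚᵘ
import Data.Rational.Unnormalised.Properties as ℚᵘ
open import Data.Sum.Base using (_⊎_; inj₁; inj₂)
open import Function.Base using (_∘_)
open import Function.Bundles using (mk⇔)
open import Relation.Binary.PropositionalEquality
  using (_≡_; _≢_; refl; sym; ≢-sym; trans; cong; cong₂; subst; subst₂; module ≡-Reasoning)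
open import Relation.Nullary using (Dec; yes; no; does; ¬?; contradiction)
open import Relation.Nullary.Decidable using (T?; does-⇔; dec-true; dec-false)
open import Relation.Unary using (Decidable)

module ℚSum = CommutativeMonoidSum ℚ.+-0-commutativeMonoid
open SemiringSum (CommutativeRing.semiring ℚ.+-*-commutativeRing) using (*-distribˡ-sum)
open module DecMembershipFin {n} = DecMembership (Fin._≟_ {n}) using (_∈?_)

private variable
  A B : Set
  n : ℕ

-- Finite sums over lists

∑ : List A → (A → ℕ) → ℕ
∑ xs f = sum (map f xs)

syntax ∑ xs (λ x → e) = ∑[ x ∈ xs ] e
infixr 8 ∑

∑-mono-∈ : ∀ (xs : List A) {f g : A → ℕ} → (∀ {x} → x ∈ xs → f x ≤ g x) → ∑ xs f ≤ ∑ xs g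
∑-mono-∈ []       f≤g = z≤n
∑-mono-∈ (x ∷ xs) f≤g = +-mono-≤ (f≤g (here refl)) (∑-mono-∈ xs (f≤g ∘ there))

∑-mono : ∀ (xs : List A) {f g : A → ℕ} → (∀ x → f x ≤ g x) → ∑ xs f ≤ ∑ xs g
∑-mono xs f≤g = ∑-mono-∈ xs (λ {x} _ → f≤g x)

∑-cong-∈ : ∀ (xs : List A) {f g : A → ℕ} → (∀ {x} → x ∈ xs → f x ≡ g x) → ∑ xs f ≡ ∑ xs g
∑-cong-∈ []       f≡g = refl
∑-cong-∈ (x ∷ xs) f≡g = cong₂ _+_ (f≡g (here refl)) (∑-cong-∈ xs (f≡g ∘ there))

∑-cong : ∀ (xs : List A) {f g : A → ℕ} → (∀ x → f x ≡ g x) → ∑ xs f ≡ ∑ xs g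
∑-cong xs f≡g = ∑-cong-∈ xs (λ {x} _ → f≡g x)

∑-+ : ∀ (xs : List A) (f g : A → ℕ) → ∑[ x ∈ xs ] (f x + g x) ≡ ∑ xs f + ∑ xs g
∑-+ []       f g = refl
∑-+ (x ∷ xs) f g = trans (cong ((f x + g x) +_) (∑-+ xs f g))
                         (+-+-comm (f x) (g x) (∑ xs f) (∑ xs g))
  where
  +-+-comm : ∀ a b c d → (a + b) + (c + d) ≡ (a + c) + (b + d)
  +-+-comm = solve-∀

∑-const : ∀ (xs : List A) c → ∑[ _ ∈ xs ] c ≡ length xs * c
∑-const []       c = refl
∑-const (_ ∷ xs) c = cong (c +_) (∑-const xs c)

∑-*ˡ : ∀ c (xs : List A) (f : A → ℕ) → ∑[ x ∈ xs ] (c * f x) ≡ c * ∑ xs f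
∑-*ˡ c []       f = sym (*-zeroʳ c)
∑-*ˡ c (x ∷ xs) f = trans (cong ((c * f x) +_) (∑-*ˡ c xs f)) (sym (*-distribˡ-+ c (f x) (∑ xs f)))

∑-swap : ∀ (xs : List A) (ys : List B) (f : A → B → ℕ) →
         ∑[ x ∈ xs ] ∑[ y ∈ ys ] f x y ≡ ∑[ y ∈ ys ] ∑[ x ∈ xs ] f x y
∑-swap []       ys f = sym (trans (∑-const ys 0) (*-zeroʳ (length ys)))
∑-swap (x ∷ xs) ys f =
  trans (cong (∑ ys (f x) +_) (∑-swap xs ys f))
        (sym (∑-+ ys (f x) (λ y → ∑[ x ∈ xs ] f x y)))

∑-filter : ∀ {P : A → Set} (P? : Decidable P) (xs : List A) (f : A → ℕ) →
           ∑ (filter P? xs) f ≡ ∑[ x ∈ xs ] (if does (P? x) then f x else 0)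
∑-filter P? []       f = refl
∑-filter P? (x ∷ xs) f with does (P? x)
... | true  = cong (f x +_) (∑-filter P? xs f)
... | false = ∑-filter P? xs f

∑-cartesianProduct : ∀ (xs : List A) (ys : List B) (f : A × B → ℕ) →
                     ∑ (cartesianProduct xs ys) f ≡ ∑[ x ∈ xs ] ∑[ y ∈ ys ] f (x , y)
∑-cartesianProduct []       ys f = refl
∑-cartesianProduct (x ∷ xs) ys f = begin
  ∑ (map (x ,_) ys ++ cartesianProduct xs ys) f
    ≡⟨ ∑-++ (map (x ,_) ys) (cartesianProduct xs ys) ⟩
  ∑ (map (x ,_) ys) f + ∑ (cartesianProduct xs ys) f
    ≡⟨ cong₂ _+_ (∑-map ys) (∑-cartesianProduct xs ys f) ⟩
  ∑ ys (λ y → f (x , y)) + (∑[ x ∈ xs ] ∑[ y ∈ ys ] f (x , y)) ∎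
  where
  open ≡-Reasoning
  ∑-++ : ∀ ps qs → ∑ (ps ++ qs) f ≡ ∑ ps f + ∑ qs f
  ∑-++ []       qs = refl
  ∑-++ (p ∷ ps) qs = trans (cong (f p +_) (∑-++ ps qs)) (sym (+-assoc (f p) (∑ ps f) (∑ qs f)))
  ∑-map : ∀ zs → ∑ (map (x ,_) zs) f ≡ ∑ zs (λ y → f (x , y))
  ∑-map []       = refl
  ∑-map (z ∷ zs) = cong (f (x , z) +_) (∑-map zs)

∑² : List A → (A → A → ℕ) → ℕ
∑² xs f = ∑[ x ∈ xs ] ∑[ y ∈ xs ] f x y

∑²-mono : ∀ (xs : List A) {f g : A → A → ℕ} → (∀ x y → f x y ≤ g x y) → ∑² xs f ≤ ∑² xs g
∑²-mono xs f≤g = ∑-mono xs (λ x → ∑-mono xs (f≤g x))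

∑²-+ : ∀ (xs : List A) (f g : A → A → ℕ) →
       ∑² xs (λ x y → f x y + g x y) ≡ ∑² xs f + ∑² xs g
∑²-+ xs f g = trans (∑-cong xs (λ x → ∑-+ xs (f x) (g x)))
                    (∑-+ xs (λ x → ∑ xs (f x)) (λ x → ∑ xs (g x)))

∑²-filter : ∀ {P : A → Set} (P? : Decidable P) (xs : List A) (f : A → A → ℕ) →
            ∑² (filter P? xs) f ≡
            ∑² xs (λ x y → if does (P? x) then (if does (P? y) then f x y else 0) else 0)
∑²-filter P? xs f = trans (∑-filter P? xs _) (∑-cong xs inner)
  where
  inner : ∀ x → (if does (P? x) then ∑ (filter P? xs) (f x) else 0) ≡
          ∑[ y ∈ xs ] (if does (P? x) then (if does (P? y) then f x y else 0) else 0)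
  inner x with does (P? x)
  ... | true  = ∑-filter P? xs (f x)
  ... | false = sym (trans (∑-const xs 0) (*-zeroʳ (length xs)))

-- The cost as a sum over ordered pairs

plus : LabelledGraph n → Fin n → Fin n → ℕ
plus G x y = if does (x Fin.≟ y) then 0 else s G (x , y)

-- Zero on the diagonal, where `similar` carries no meaning; sums may then run over all ordered
-- pairs of a list, which makes the variables interchangeable.
err : LabelledGraph n → (Fin n → ℕ) → Fin n → Fin n → ℕ
err G ℓ x y =
  if does (x Fin.≟ y) then 0 else if does (ℓ x ≟ ℓ y) then 1 ∸ s G (x , y) else s G (x , y)

-- `below` counts each unordered pair in one of its two orders. The summand is symmetric, so adding
-- the transpose supplies the other order.
cost-double : ∀ (G : LabelledGraph n) ℓ → 2 * cost G ℓ ≡ ∑² (allFin n) (err G ℓ)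
cost-double {n} G ℓ = begin
  2 * cost G ℓ
    ≡⟨ cong (2 *_) (trans (filter-recombine (pairs n)) pairs-∑²) ⟩
  2 * ∑² V below
    ≡⟨ 2*-+ (∑² V below) ⟩
  ∑² V below + ∑² V below
    ≡⟨ cong (∑² V below +_) (∑-swap V V below) ⟩
  ∑² V below + ∑² V (λ x y → below y x)
    ≡⟨ ∑²-+ V below (λ x y → below y x) ⟨
  ∑² V (λ x y → below x y + below y x)
    ≡⟨ ∑-cong V (λ x → ∑-cong V (below-err x)) ⟩
  ∑² V (err G ℓ) ∎
  where
  open ≡-Reasoning
  V = allFin n

  2*-+ : ∀ a → 2 * a ≡ a + a
  2*-+ = solve-∀

  d : Fin n × Fin n → ℕ
  d p = if does (together? ℓ p) then 1 ∸ s G p else s G p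

  below : Fin n → Fin n → ℕ
  below x y = if does (x Fin.<? y) then d (x , y) else 0

  filter-recombine : ∀ ps → (∑[ p ∈ filter (together? ℓ) ps ] (1 ∸ s G p))
               + ∑ (filter (¬? ∘ together? ℓ) ps) (s G) ≡ ∑ ps d
  filter-recombine ps = begin
    _ ≡⟨ cong₂ _+_ (∑-filter (together? ℓ) ps _) (∑-filter (¬? ∘ together? ℓ) ps _) ⟩
    _ ≡⟨ ∑-+ ps _ _ ⟨
    _ ≡⟨ ∑-cong ps pointwise ⟩
    ∑ ps d ∎
    where
    pointwise : ∀ p → (if does (together? ℓ p) then 1 ∸ s G p else 0)
                    + (if not (does (together? ℓ p)) then s G p else 0) ≡ d p
    pointwise p with does (together? ℓ p)
    ... | true  = +-identityʳ (1 ∸ s G p)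
    ... | false = refl

  pairs-∑² : ∑ (pairs n) d ≡ ∑² V below
  pairs-∑² = trans (∑-filter (uncurry Fin._<?_) (cartesianProduct V V) d)
                   (∑-cartesianProduct V V _)

  d-sym : ∀ x y → d (x , y) ≡ d (y , x)
  d-sym x y rewrite symmetric G x y | does-⇔ (mk⇔ sym sym) (ℓ x ≟ ℓ y) (ℓ y ≟ ℓ x) = refl

  below-err : ∀ x y → below x y + below y x ≡ err G ℓ x y
  below-err x y = go (x Fin.≟ y) (x Fin.<? y) (y Fin.<? x)
    where
    -- Trichotomy: off the diagonal exactly one strict comparison holds, on it none.
    go : (eq : Dec (x ≡ y)) (lt : Dec (x Fin.< y)) (gt : Dec (y Fin.< x)) →
         (if does lt then d (x , y) else 0) + (if does gt then d (y , x) else 0) ≡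
         (if does eq then 0 else d (x , y))
    go (yes _)    (no _)     (no _)     = refl
    go (no _)     (yes _)    (no _)     = +-identityʳ (d (x , y))
    go (no _)     (no _)     (yes _)    = d-sym y x
    go (no _)     (yes x<y)  (yes y<x)  = contradiction y<x (<-asym x<y)
    go (yes refl) (yes x<x)  _          = contradiction x<x (n≮n _)
    go (yes refl) (no _)     (yes x<x)  = contradiction x<x (n≮n _)
    go (no x≢y)   (no x≮y)   (no y≮x)   =
      contradiction (Fin.toℕ-injective (≤-antisym (≮⇒≥ y≮x) (≮⇒≥ x≮y))) x≢y

-- Natural numbers as rationals

-- Opaque because the gcd normalisation inside _/_ makes conversion checking
-- explode.
opaque
  fromℕ : ℕ → ℚ
  fromℕ a = ℤ.+ a / 1

  toℚᵘ-fromℕ : ∀ a → toℚᵘ (fromℕ a) ℚᵘ.≃ ℚᵘ.mkℚᵘ (ℤ.+ a) 0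
  toℚᵘ-fromℕ a = ℚ.toℚᵘ-fromℚᵘ (ℚᵘ.mkℚᵘ (ℤ.+ a) 0)

  fromℕ-mono : ∀ {a b} → a ≤ b → fromℕ a ℚ.≤ fromℕ b
  fromℕ-mono {a} {b} a≤b = ℚ.toℚᵘ-cancel-≤
    (ℚᵘ.≤-respˡ-≃ (ℚᵘ.≃-sym (toℚᵘ-fromℕ a)) (ℚᵘ.≤-respʳ-≃ (ℚᵘ.≃-sym (toℚᵘ-fromℕ b))
      (ℚᵘ.*≤* (ℤ.*-monoʳ-≤-nonNeg (ℤ.+ 1) (ℤ.+≤+ a≤b)))))

  fromℕ-+ : ∀ a b → fromℕ (a + b) ≡ fromℕ a ℚ.+ fromℕ b
  fromℕ-+ a b = ℚ.toℚᵘ-injective (begin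
    toℚᵘ (fromℕ (a + b))                       ≈⟨ toℚᵘ-fromℕ (a + b) ⟩
    ℚᵘ.mkℚᵘ (ℤ.+ (a + b)) 0                       ≈⟨ ℚᵘ.*≡* (cong (ℤ._* (ℤ.+ 1)) (sym
      (cong₂ ℤ._+_ (ℤ.*-identityʳ (ℤ.+ a)) (ℤ.*-identityʳ (ℤ.+ b))))) ⟩
    ℚᵘ.mkℚᵘ (ℤ.+ a) 0 ℚᵘ.+ ℚᵘ.mkℚᵘ (ℤ.+ b) 0        ≈⟨ ℚᵘ.+-cong (toℚᵘ-fromℕ a) (toℚᵘ-fromℕ b) ⟨
    toℚᵘ (fromℕ a) ℚᵘ.+ toℚᵘ (fromℕ b)          ≈⟨ ℚ.toℚᵘ-homo-+ (fromℕ a) (fromℕ b) ⟨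
    toℚᵘ (fromℕ a ℚ.+ fromℕ b)                  ∎)
    where open ℚᵘ.≃-Reasoning

  /-*-cancel : ∀ a m .{{_ : NonZero m}} → (ℤ.+ a / m) ℚ.* fromℕ m ≡ fromℕ a
  /-*-cancel a m@(suc _) = ℚ.toℚᵘ-injective (begin
    toℚᵘ ((ℤ.+ a / m) ℚ.* fromℕ m)            ≈⟨ ℚ.toℚᵘ-homo-* (ℤ.+ a / m) (fromℕ m) ⟩
    toℚᵘ (ℤ.+ a / m) ℚᵘ.* toℚᵘ (fromℕ m)
      ≈⟨ ℚᵘ.*-cong (ℚ.toℚᵘ-fromℚᵘ (ℤ.+ a ℚᵘ./ m)) (toℚᵘ-fromℕ m) ⟩
    (ℤ.+ a ℚᵘ./ m) ℚᵘ.* ℚᵘ.mkℚᵘ (ℤ.+ m) 0      ≈⟨ ℚᵘ.*≡* (ℤ.*-assoc (ℤ.+ a) (ℤ.+ m) (ℤ.+ 1)) ⟩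
    ℚᵘ.mkℚᵘ (ℤ.+ a) 0                         ≈⟨ toℚᵘ-fromℕ a ⟨
    toℚᵘ (fromℕ a)                          ∎)
    where open ℚᵘ.≃-Reasoning

  fromℕ-* : ∀ a b → fromℕ (a * b) ≡ fromℕ a ℚ.* fromℕ b
  fromℕ-* a b = ℚ.toℚᵘ-injective (begin
    toℚᵘ (fromℕ (a * b))                       ≈⟨ toℚᵘ-fromℕ (a * b) ⟩
    ℚᵘ.mkℚᵘ (ℤ.+ (a * b)) 0                      ≈⟨ ℚᵘ.*≡* (cong (ℤ._* (ℤ.+ 1)) (ℤ.pos-* a b)) ⟩
    ℚᵘ.mkℚᵘ (ℤ.+ a) 0 ℚᵘ.* ℚᵘ.mkℚᵘ (ℤ.+ b) 0       ≈⟨ ℚᵘ.*-cong (toℚᵘ-fromℕ a) (toℚᵘ-fromℕ b) ⟨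
    toℚᵘ (fromℕ a) ℚᵘ.* toℚᵘ (fromℕ b)         ≈⟨ ℚ.toℚᵘ-homo-* (fromℕ a) (fromℕ b) ⟨
    toℚᵘ (fromℕ a ℚ.* fromℕ b)                 ∎)
    where open ℚᵘ.≃-Reasoning

  fromℕ-nonNeg : ∀ a → ℚ.NonNegative (fromℕ a)
  fromℕ-nonNeg a = ℚ.normalize-nonNeg a 1

  fromℕ-pos : ∀ a .{{_ : NonZero a}} → ℚ.Positive (fromℕ a)
  fromℕ-pos a = ℚ.normalize-pos a 1

  fromℕ-0 : fromℕ 0 ≡ ℚ.0ℚ
  fromℕ-0 = refl

  fromℕ-1 : fromℕ 1 ≡ ℚ.1ℚ
  fromℕ-1 = refl

-- Through this bound, averages over pivots can be estimated by sums in ℕ.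
ℚsum-≤-∑ : ∀ (xs : List A) {E : Fin (length xs) → ℚ} (b : A → ℕ) →
           (∀ i → E i ℚ.≤ fromℕ (b (lookup xs i))) → ℚSum.sum E ℚ.≤ fromℕ (∑ xs b)
ℚsum-≤-∑ []       b E≤b = ℚ.≤-reflexive (sym fromℕ-0)
ℚsum-≤-∑ (x ∷ xs) b E≤b = ℚ.≤-trans
  (ℚ.+-mono-≤ (E≤b zero) (ℚsum-≤-∑ xs b (λ i → E≤b (suc i))))
  (ℚ.≤-reflexive (sym (fromℕ-+ (b x) (∑ xs b))))

-- Charging the errors of a pivot

near : LabelledGraph n → Fin n → Fin n → Bool
near G v x = does (v Fin.≟ x) ∨ similar G v x

near-refl : ∀ (G : LabelledGraph n) v → near G v v ≡ true
near-refl G v rewrite dec-true (v Fin.≟ v) refl = refl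

near-≢ : ∀ (G : LabelledGraph n) {v x} → v ≢ x → near G v x ≡ similar G v x
near-≢ G {v} {x} v≢x rewrite dec-false (v Fin.≟ x) v≢x = refl

near-sym : ∀ (G : LabelledGraph n) v x → near G v x ≡ near G x v
near-sym G v x = cong₂ _∨_ (does-⇔ (mk⇔ sym sym) (v Fin.≟ x) (x Fin.≟ v)) (symmetric G v x)

-- The pairs settled in the round of `v`: once the cluster of `v` contains an endpoint, it is
-- decided whether the pair ends up together.
touches : LabelledGraph n → Fin n → Fin n → Fin n → Bool
touches G v x y = near G v x ∨ near G v y

-- Summed over ordered pairs, twice the cost that is settled when the cluster
-- of the pivot v is split off.
pivotErr : LabelledGraph n → Fin n → Fin n → Fin n → ℕ
pivotErr G v x y =
  if does (x Fin.≟ y) then 0 else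
  if near G v x then (if near G v y then 1 ∸ s G (x , y) else s G (x , y))
                else (if near G v y then s G (x , y) else 0)

-- The cluster of `v` follows the labels at `v`, so pairs containing the pivot cost nothing and only
-- triangles on three distinct vertices need charging.
pivotErr-left : ∀ (G : LabelledGraph n) v y → pivotErr G v v y ≡ 0
pivotErr-left G v y with v Fin.≟ y
... | yes _ = refl
... | no  _ rewrite near-refl G v with similar G v y
...   | true  = refl
...   | false = refl

pivotErr-right : ∀ (G : LabelledGraph n) v x → pivotErr G v x v ≡ 0
pivotErr-right G v x with x Fin.≟ v
... | yes _ = refl
... | no x≢v rewrite near-refl G v | near-≢ G (≢-sym x≢v) | symmetric G x v with similar G v x
...   | true  = refl
...   | false = refl

removed : LabelledGraph n → (Fin n → Fin n → ℕ) → Fin n → Fin n → Fin n → ℕ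
removed G f v x y = if touches G v x y then f x y else 0

-- The terms on the right stand for the edges xy, vx and vy of a triangle, each taken with the
-- opposite vertex as pivot.
pivotErr-charge : ∀ (G : LabelledGraph n) ℓ v x y →
  pivotErr G v x y ≤
  removed G (err G ℓ) v x y + removed G (err G ℓ) y v x + removed G (err G ℓ) x v y
pivotErr-charge G ℓ v x y = go (v Fin.≟ x) (v Fin.≟ y) (x Fin.≟ y)
  where
  num : Bool → ℕ
  num b = if b then 1 else 0

  -- `c`, `a`, `b` are the labels of xy, vx, vy. The left side is 1 only if exactly two of them are
  -- "+". In the three absurd clauses `ℓ` would respect all three labels, against transitivity of
  -- equality.
  triangle : (xy : Dec (ℓ x ≡ ℓ y)) (vx : Dec (ℓ v ≡ ℓ x)) (vy : Dec (ℓ v ≡ ℓ y)) (c a b : Bool) →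
    (if a then (if b then 1 ∸ num c else num c) else (if b then num c else 0)) ≤
      (if a ∨ b then (if does xy then 1 ∸ num c else num c) else 0)
    + (if b ∨ c then (if does vx then 1 ∸ num a else num a) else 0)
    + (if a ∨ c then (if does vy then 1 ∸ num b else num b) else 0)
  triangle _        _        _        true  true  true  = z≤n
  triangle (no _)   _        _        true  true  false = s≤s z≤n
  triangle (yes _)  (no _)   _        true  true  false = s≤s z≤n
  triangle (yes _)  (yes _)  (yes _)  true  true  false = s≤s z≤n
  triangle (yes p)  (yes q)  (no ¬r)  true  true  false = contradiction (trans q p) ¬r
  triangle (no _)   _        _        true  false true  = s≤s z≤n
  triangle (yes _)  (yes _)  _        true  false true  = s≤s z≤n
  triangle (yes _)  (no _)   (no _)   true  false true  = s≤s z≤n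
  triangle (yes p)  (no ¬q)  (yes r)  true  false true  = contradiction (trans r (sym p)) ¬q
  triangle (yes _)  _        _        false true  true  = s≤s z≤n
  triangle (no _)   (no _)   _        false true  true  = s≤s z≤n
  triangle (no _)   (yes _)  (no _)   false true  true  = s≤s z≤n
  triangle (no ¬p)  (yes q)  (yes r)  false true  true  = contradiction (trans (sym q) r) ¬p
  triangle _        _        _        true  false false = z≤n
  triangle _        _        _        false true  false = z≤n
  triangle _        _        _        false false true  = z≤n
  triangle _        _        _        false false false = z≤n

  go : Dec (v ≡ x) → Dec (v ≡ y) → Dec (x ≡ y) → pivotErr G v x y ≤
    removed G (err G ℓ) v x y + removed G (err G ℓ) y v x + removed G (err G ℓ) x v y
  go (yes refl) _          _          = ≤-trans (≤-reflexive (pivotErr-left G v y)) z≤n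
  go (no _)     (yes refl) _          = ≤-trans (≤-reflexive (pivotErr-right G v x)) z≤n
  go (no _)     (no _)     (yes refl) rewrite dec-true (x Fin.≟ x) refl = z≤n
  go (no v≢x)   (no v≢y)   (no x≢y)
    rewrite near-sym G y v | near-sym G y x | near-sym G x v
          | near-≢ G v≢x | near-≢ G v≢y | near-≢ G x≢y
          | dec-false (v Fin.≟ x) v≢x | dec-false (v Fin.≟ y) v≢y | dec-false (x Fin.≟ y) x≢y
    = triangle (ℓ x ≟ ℓ y) (ℓ v ≟ ℓ x) (ℓ v ≟ ℓ y) (similar G x y) (similar G v x) (similar G v y)

survivors : LabelledGraph n → Fin n → List (Fin n) → List (Fin n)
survivors G v = filterᵇ (not ∘ near G v)

-- A pair that the cluster of `v` does not meet lies within the survivors.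
∑²-removed-survivors : ∀ (G : LabelledGraph n) f v R →
  ∑² R (removed G f v) + ∑² (survivors G v R) f ≡ ∑² R f
∑²-removed-survivors G f v R = begin
  ∑² R (removed G f v) + ∑² (survivors G v R) f
    ≡⟨ cong (∑² R (removed G f v) +_) (∑²-filter _ R f) ⟩
  ∑² R (removed G f v) + ∑² R kept
    ≡⟨ ∑²-+ R (removed G f v) kept ⟨
  ∑² R (λ x y → removed G f v x y + kept x y)
    ≡⟨ ∑-cong R (λ x → ∑-cong R (pointwise x)) ⟩
  ∑² R f ∎
  where
  open ≡-Reasoning
  kept : _ → _ → ℕ
  kept x y = if not (near G v x) then (if not (near G v y) then f x y else 0) else 0

  pointwise : ∀ x y → removed G f v x y + kept x y ≡ f x y
  pointwise x y with near G v x | near G v y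
  ... | true  | _     = +-identityʳ (f x y)
  ... | false | true  = +-identityʳ (f x y)
  ... | false | false = refl

∑-removed-survivors : ∀ (G : LabelledGraph n) f R →
  ∑[ v ∈ R ] ∑² R (removed G f v) + ∑[ v ∈ R ] ∑² (survivors G v R) f ≡ length R * ∑² R f
∑-removed-survivors G f R = begin
  ∑[ v ∈ R ] ∑² R (removed G f v) + ∑[ v ∈ R ] ∑² (survivors G v R) f
    ≡⟨ ∑-+ R _ _ ⟨
  ∑[ v ∈ R ] (∑² R (removed G f v) + ∑² (survivors G v R) f)
    ≡⟨ ∑-cong R (λ v → ∑²-removed-survivors G f v R) ⟩
  ∑[ v ∈ R ] ∑² R f
    ≡⟨ ∑-const R (∑² R f) ⟩
  length R * ∑² R f ∎
  where open ≡-Reasoning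

-- Summed over all ordered triples from `R`, the three charged terms are one sum with its variables
-- renamed; this is the source of the factor 3.
∑-pivotErr-≤ : ∀ (G : LabelledGraph n) ℓ R →
  ∑[ v ∈ R ] ∑² R (pivotErr G v) ≤ 3 * ∑[ v ∈ R ] ∑² R (removed G (err G ℓ) v)
∑-pivotErr-≤ G ℓ R = begin
  ∑[ v ∈ R ] ∑² R (pivotErr G v)
    ≤⟨ ∑-mono R (λ v → ∑²-mono R (pivotErr-charge G ℓ v)) ⟩
  ∑[ v ∈ R ] ∑² R (λ x y → r v x y + r y v x + r x v y)
    ≡⟨ ∑-cong R (λ v → trans (∑²-+ R (λ x y → r v x y + r y v x) (λ x y → r x v y))
                             (cong (_+ ∑² R (λ x y → r x v y)) (∑²-+ R (r v) (λ x y → r y v x)))) ⟩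
  ∑[ v ∈ R ] (∑² R (r v) + ∑² R (λ x y → r y v x) + ∑² R (λ x y → r x v y))
    ≡⟨ ∑-+ R _ _ ⟩
  (∑[ v ∈ R ] (∑² R (r v) + ∑² R (λ x y → r y v x))) + (∑[ v ∈ R ] ∑² R (λ x y → r x v y))
    ≡⟨ cong₂ _+_ (∑-+ R _ _) x-first ⟩
  S + (∑[ v ∈ R ] ∑² R (λ x y → r y v x)) + S
    ≡⟨ cong (λ t → S + t + S) y-first ⟩
  S + S + S
    ≡⟨ triple S ⟩
  3 * S ∎
  where
  open ≤-Reasoning
  r = removed G (err G ℓ)
  S = ∑[ v ∈ R ] ∑² R (r v)

  triple : ∀ a → a + a + a ≡ 3 * a
  triple = solve-∀

  x-first : ∑[ v ∈ R ] ∑[ x ∈ R ] ∑[ y ∈ R ] r x v y ≡ S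
  x-first = ∑-swap R R (λ v x → ∑[ y ∈ R ] r x v y)

  y-first : ∑[ v ∈ R ] ∑[ x ∈ R ] ∑[ y ∈ R ] r y v x ≡ S
  y-first = trans (∑-cong R (λ v → ∑-swap R R (λ x y → r y v x)))
                  (∑-swap R R (λ v y → ∑[ x ∈ R ] r y v x))

-- Every pair either is settled or survives, so the error of `ℓ` that disappears in a round pays for
-- the round threefold. Thus 3 e(R) is a potential that, with the cost of the round added, does not
-- grow on average.
charging : ∀ (G : LabelledGraph n) ℓ R →
  ∑[ v ∈ R ] (∑² R (pivotErr G v) + 3 * ∑² (survivors G v R) (err G ℓ)) ≤
  length R * (3 * ∑² R (err G ℓ))
charging G ℓ R = begin
  ∑[ v ∈ R ] (∑² R (pivotErr G v) + 3 * ∑² (survivors G v R) e)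
    ≡⟨ trans (∑-+ R _ _) (cong ((∑[ v ∈ R ] ∑² R (pivotErr G v)) +_) (∑-*ˡ 3 R _)) ⟩
  (∑[ v ∈ R ] ∑² R (pivotErr G v)) + 3 * S
    ≤⟨ +-monoˡ-≤ (3 * S) (∑-pivotErr-≤ G ℓ R) ⟩
  3 * (∑[ v ∈ R ] ∑² R (removed G e v)) + 3 * S
    ≡⟨ *-distribˡ-+ 3 (∑[ v ∈ R ] ∑² R (removed G e v)) S ⟨
  3 * ((∑[ v ∈ R ] ∑² R (removed G e v)) + S)
    ≡⟨ cong (3 *_) (∑-removed-survivors G e R) ⟩
  3 * (length R * ∑² R e)
    ≡⟨ rotate (length R) (∑² R e) ⟩
  length R * (3 * ∑² R e) ∎
  where
  open ≤-Reasoning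
  e = err G ℓ
  S = ∑[ v ∈ R ] ∑² (survivors G v R) e
  rotate : ∀ m a → 3 * (m * a) ≡ m * (3 * a)
  rotate = solve-∀

-- Decay of the "+" pairs

degree : LabelledGraph n → List (Fin n) → Fin n → ℕ
degree G R x = ∑ R (plus G x)

-- Choosing a "+" neighbour `v` of `x` settles every pair at `x`. The squares count the triples in
-- which xv and xy are both "+", and each of them contributes the settled pair xy.
∑-degree²-≤ : ∀ (G : LabelledGraph n) R →
  ∑[ x ∈ R ] (degree G R x * degree G R x) ≤ ∑[ v ∈ R ] ∑² R (removed G (plus G) v)
∑-degree²-≤ G R = begin
  ∑[ x ∈ R ] (degree G R x * degree G R x)
    ≡⟨ ∑-cong R (λ x → ∑-*ˡ (degree G R x) R (plus G x)) ⟨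
  ∑[ x ∈ R ] ∑[ v ∈ R ] (degree G R x * plus G x v)
    ≡⟨ ∑-cong R (λ x → ∑-cong R (λ v →
         trans (*-comm (degree G R x) (plus G x v)) (sym (∑-*ˡ (plus G x v) R (plus G x))))) ⟩
  ∑[ x ∈ R ] ∑[ v ∈ R ] ∑[ y ∈ R ] (plus G x v * plus G x y)
    ≤⟨ ∑-mono R (λ x → ∑²-mono R (pointwise x)) ⟩
  ∑[ x ∈ R ] ∑[ v ∈ R ] ∑[ y ∈ R ] removed G (plus G) v x y
    ≡⟨ ∑-swap R R (λ x v → ∑[ y ∈ R ] removed G (plus G) v x y) ⟩
  ∑[ v ∈ R ] ∑² R (removed G (plus G) v) ∎
  where
  open ≤-Reasoning
  pointwise : ∀ x v y → plus G x v * plus G x y ≤ removed G (plus G) v x y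
  pointwise x v y rewrite near-sym G v x with x Fin.≟ v
  ... | yes _ = z≤n
  ... | no  _ with similar G x v
  ...   | true  = ≤-reflexive (+-identityʳ (plus G x y))
  ...   | false = z≤n

-- The two sides differ by the square of the distance between `a` and `b`.
2ab≤a²+b² : ∀ a b → 2 * (a * b) ≤ a * a + b * b
2ab≤a²+b² a b with ≤-total a b
... | inj₁ a≤b = subst (λ b → 2 * (a * b) ≤ a * a + b * b) (m+[n∸m]≡n a≤b)
                   (m+n≤o⇒m≤o _ (≤-reflexive (square a (b ∸ a))))
  where
  square : ∀ a d → 2 * (a * (a + d)) + d * d ≡ a * a + (a + d) * (a + d)
  square = solve-∀
... | inj₂ b≤a = subst (λ a → 2 * (a * b) ≤ a * a + b * b) (m+[n∸m]≡n b≤a)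
                   (m+n≤o⇒m≤o _ (≤-reflexive (square b (a ∸ b))))
  where
  square : ∀ b d → 2 * ((b + d) * b) + d * d ≡ (b + d) * (b + d) + b * b
  square = solve-∀

-- A linearised Cauchy-Schwarz inequality: 2ab ≤ a² + b² with a = (i + 1) d(x) and b = m, summed
-- over x. The factor 2i + 2 is weakened to 2i + 1 = (i + 1)² - i², the difference that `plus-decay`
-- has to absorb.
removed-plus-≥ : ∀ (G : LabelledGraph n) i R → let m = length R in
  suc (2 * i) * (m * ∑² R (plus G)) ≤
  suc i * suc i * (∑[ v ∈ R ] ∑² R (removed G (plus G) v)) + m * (m * m)
removed-plus-≥ G i R = begin
  suc (2 * i) * (m * ∑ R d)
    ≡⟨ trans (sym (*-assoc (suc (2 * i)) m _)) (sym (∑-*ˡ (suc (2 * i) * m) R d)) ⟩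
  ∑[ x ∈ R ] (suc (2 * i) * m * d x)
    ≤⟨ ∑-mono R (λ x → bound (d x)) ⟩
  ∑[ x ∈ R ] (suc i * suc i * (d x * d x) + m * m)
    ≡⟨ trans (∑-+ R _ _) (cong₂ _+_ (∑-*ˡ (suc i * suc i) R _) (∑-const R (m * m))) ⟩
  suc i * suc i * (∑[ x ∈ R ] (d x * d x)) + m * (m * m)
    ≤⟨ +-monoˡ-≤ (m * (m * m)) (*-monoʳ-≤ (suc i * suc i) (∑-degree²-≤ G R)) ⟩
  suc i * suc i * (∑[ v ∈ R ] ∑² R (removed G (plus G) v)) + m * (m * m) ∎
  where
  open ≤-Reasoning
  m = length R
  d = degree G R

  bound : ∀ a → suc (2 * i) * m * a ≤ suc i * suc i * (a * a) + m * m
  bound a = begin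
    suc (2 * i) * m * a            ≤⟨ m≤n+m _ (m * a) ⟩
    m * a + suc (2 * i) * m * a    ≡⟨ eq₁ i m a ⟩
    2 * ((suc i * a) * m)          ≤⟨ 2ab≤a²+b² (suc i * a) m ⟩
    (suc i * a) * (suc i * a) + m * m ≡⟨ eq₂ (suc i) a m ⟩
    suc i * suc i * (a * a) + m * m ∎
    where
    eq₁ : ∀ i m a → m * a + (1 + 2 * i) * m * a ≡ 2 * (((1 + i) * a) * m)
    eq₁ = solve-∀
    eq₂ : ∀ j a m → (j * a) * (j * a) + m * m ≡ j * j * (a * a) + m * m
    eq₂ = solve-∀

-- The factor on W rises from i² to (i + 1)², and `removed-plus-≥` bounds the excess (2i + 1) m W.
-- Its remainder m³ is at most m N² and uses up one of the k + 1 copies of N².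
plus-decay : ∀ (G : LabelledGraph n) i k N R → length R ≤ N →
  ∑[ v ∈ R ] (suc i * suc i * ∑² (survivors G v R) (plus G) + k * (N * N)) ≤
  length R * (i * i * ∑² R (plus G) + suc k * (N * N))
-- To avoid subtraction in ℕ, `j² * D` is added to both sides, which completes `S` to `m * W`.
plus-decay G i k N R m≤N = +-cancelʳ-≤ (j² * D) _ _ (begin
  (∑[ v ∈ R ] (j² * ∑² (survivors G v R) (plus G) + k * (N * N))) + j² * D
    ≡⟨ cong (_+ j² * D) (trans (∑-+ R _ _) (cong₂ _+_ (∑-*ˡ j² R _) (∑-const R (k * (N * N))))) ⟩
  (j² * S + m * (k * (N * N))) + j² * D
    ≡⟨ collect j² S D (m * (k * (N * N))) ⟩
  j² * (D + S) + m * (k * (N * N))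
    ≡⟨ cong (λ t → j² * t + m * (k * (N * N))) (∑-removed-survivors G (plus G) R) ⟩
  j² * (m * W) + m * (k * (N * N))
    ≡⟨ expand i m W (m * (k * (N * N))) ⟩
  suc (2 * i) * (m * W) + (m * (i * i * W) + m * (k * (N * N)))
    ≤⟨ +-monoˡ-≤ _ (removed-plus-≥ G i R) ⟩
  j² * D + m * (m * m) + (m * (i * i * W) + m * (k * (N * N)))
    ≤⟨ +-monoˡ-≤ _ (+-monoʳ-≤ (j² * D) (*-monoʳ-≤ m (*-mono-≤ m≤N m≤N))) ⟩
  j² * D + m * (N * N) + (m * (i * i * W) + m * (k * (N * N)))
    ≡⟨ regroup (j² * D) m N i W k ⟩
  m * (i * i * W + suc k * (N * N)) + j² * D ∎)
  where
  open ≤-Reasoning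
  m = length R
  j² = suc i * suc i
  W = ∑² R (plus G)
  D = ∑[ v ∈ R ] ∑² R (removed G (plus G) v)
  S = ∑[ v ∈ R ] ∑² (survivors G v R) (plus G)

  collect : ∀ j s d c → (j * s + c) + j * d ≡ j * (d + s) + c
  collect = solve-∀
  expand : ∀ i m w c → (1 + i) * (1 + i) * (m * w) + c ≡
                       (1 + 2 * i) * (m * w) + (m * (i * i * w) + c)
  expand = solve-∀
  regroup : ∀ d m N i w k → d + m * (N * N) + (m * (i * i * w) + m * (k * (N * N))) ≡
                            m * (i * i * w + (1 + k) * (N * N)) + d
  regroup = solve-∀

survivors-plus-≤ : ∀ (G : LabelledGraph n) v R → ∑² (survivors G v R) (plus G) ≤ ∑² R (plus G)
survivors-plus-≤ G v R = m+n≤o⇒n≤o (∑² R (removed G (plus G) v))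
  (≤-reflexive (∑²-removed-survivors G (plus G) v R))

-- The cluster of a pivot and its labels

removeAt-↭ : ∀ (xs : List A) i → lookup xs i ∷ removeAt xs i ↭ xs
removeAt-↭ (x ∷ xs) zero    = ↭-refl
removeAt-↭ (x ∷ xs) (suc i) = ↭-trans (swap _ _ ↭-refl) (prep x (removeAt-↭ xs i))

filterᵇ-++-↭ : ∀ (p : A → Bool) xs → filterᵇ p xs ++ filterᵇ (not ∘ p) xs ↭ xs
filterᵇ-++-↭ p []       = ↭-refl
filterᵇ-++-↭ p (x ∷ xs) with p x
... | true  = prep x (filterᵇ-++-↭ p xs)
... | false = ↭-trans (shift x (filterᵇ p xs) _) (prep x (filterᵇ-++-↭ p xs))

-- `near` differs from `similar` only at the pivot, which occurs in `R` just once; deleting that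
-- position has the same effect as filtering it out.
filterᵇ-removeAt-survivors : ∀ (G : LabelledGraph n) R i → Unique R → let v = lookup R i in
  filterᵇ (not ∘ similar G v) (removeAt R i) ≡ survivors G v R
filterᵇ-removeAt-survivors G (v ∷ R) zero (v∉R ∷ _) rewrite near-refl G v = others R v∉R
  where
  others : ∀ xs → All (v ≢_) xs → filterᵇ (not ∘ similar G v) xs ≡ survivors G v xs
  others []       []           = refl
  others (x ∷ xs) (v≢x ∷ v∉xs) rewrite near-≢ G v≢x with similar G v x
  ... | true  = others xs v∉xs
  ... | false = cong (x ∷_) (others xs v∉xs)
filterᵇ-removeAt-survivors G (r ∷ R) (suc i) (r∉R ∷ R!)
  rewrite near-≢ G (≢-sym (All.lookup r∉R (∈-lookup {xs = R} i)))
  with similar G (lookup R i) r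
... | true  = filterᵇ-removeAt-survivors G R i R!
... | false = cong (r ∷_) (filterᵇ-removeAt-survivors G R i R!)

pivotCluster : LabelledGraph n → (R : List (Fin n)) → Fin (length R) → List (Fin n)
pivotCluster G R i = lookup R i ∷ filterᵇ (similar G (lookup R i)) (removeAt R i)

-- Restricted to `R`, since `near` may also hold of vertices settled earlier, which the cluster does
-- not list.
∈?-pivotCluster : ∀ (G : LabelledGraph n) R i {x} → x ∈ R →
                  does (x ∈? pivotCluster G R i) ≡ near G (lookup R i) x
∈?-pivotCluster G R i {x} x∈R = go (lookup R i Fin.≟ x)
  where
  v = lookup R i

  go : Dec (v ≡ x) → does (x ∈? pivotCluster G R i) ≡ near G v x
  go (yes refl) = trans (dec-true (x ∈? pivotCluster G R i) (here refl)) (sym (near-refl G v))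
  go (no v≢x)   = trans
    (does-⇔ (mk⇔ to from) (x ∈? pivotCluster G R i) (T? (similar G v x)))
    (sym (near-≢ G v≢x))
    where
    to : x ∈ pivotCluster G R i → T (similar G v x)
    to (here x≡v)  = contradiction (sym x≡v) v≢x
    to (there x∈N) = proj₂ (∈-filter⁻ (T? ∘ similar G v) {xs = removeAt R i} x∈N)

    from : T (similar G v x) → x ∈ pivotCluster G R i
    from v~x with ∈-resp-↭ (↭-sym (removeAt-↭ R i)) x∈R
    ... | here x≡v   = here x≡v
    ... | there x∈R′ = there (∈-filter⁺ (T? ∘ similar G v) x∈R′ v~x)

-- The new cluster gets label 0 and all other labels are shifted by one. Pairs meeting the cluster
-- are thereby settled, and comparisons among survivors do not change.
∑²-err-∷ : ∀ (G : LabelledGraph n) R i 𝒞 → let v = lookup R i in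
  ∑² R (err G (labelling (pivotCluster G R i ∷ 𝒞))) ≡
  ∑² R (pivotErr G v) + ∑² (survivors G v R) (err G (labelling 𝒞))
∑²-err-∷ G R i 𝒞 = begin
  ∑² R (err G (labelling (pivotCluster G R i ∷ 𝒞)))
    ≡⟨ ∑-cong-∈ R (λ {x} x∈R → ∑-cong-∈ R (λ {y} y∈R →
         pointwise x y (∈?-pivotCluster G R i x∈R) (∈?-pivotCluster G R i y∈R))) ⟩
  ∑² R (λ x y → pivotErr G v x y + kept x y)
    ≡⟨ ∑²-+ R (pivotErr G v) kept ⟩
  ∑² R (pivotErr G v) + ∑² R kept
    ≡⟨ cong (∑² R (pivotErr G v) +_) (∑²-filter _ R (err G (labelling 𝒞))) ⟨
  ∑² R (pivotErr G v) + ∑² (survivors G v R) (err G (labelling 𝒞)) ∎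
  where
  open ≡-Reasoning
  v = lookup R i

  kept : _ → _ → ℕ
  kept x y =
    if not (near G v x) then (if not (near G v y) then err G (labelling 𝒞) x y else 0) else 0

  pointwise : ∀ x y → does (x ∈? pivotCluster G R i) ≡ near G v x →
              does (y ∈? pivotCluster G R i) ≡ near G v y →
              err G (labelling (pivotCluster G R i ∷ 𝒞)) x y ≡ pivotErr G v x y + kept x y
  pointwise x y ∈x ∈y rewrite ∈x | ∈y with does (x Fin.≟ y) | near G v x | near G v y
  ... | true  | true  | _     = refl
  ... | true  | false | true  = refl
  ... | true  | false | false = refl
  ... | false | true  | true  = sym (+-identityʳ _)
  ... | false | true  | false = sym (+-identityʳ _)
  ... | false | false | true  = sym (+-identityʳ _)
  -- Both labels are successors, and comparing successors computes to comparing the labels given by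
  -- `𝒞`.
  ... | false | false | false = refl

labelling-singletons-injective : ∀ (R : List (Fin n)) {x y} → x ∈ R → y ∈ R →
  labelling (map [_] R) x ≡ labelling (map [_] R) y → x ≡ y
labelling-singletons-injective (r ∷ R) {x} {y} x∈ y∈ eq with x Fin.≟ r | y Fin.≟ r
... | yes refl | yes refl = refl
-- If just one of `x`, `y` were the head, `eq` would equate zero with a successor.
... | no x≢r   | no y≢r   =
  labelling-singletons-injective R (tail x≢r x∈) (tail y≢r y∈) (suc-injective eq)

∑²-err-singletons : ∀ (G : LabelledGraph n) R →
  ∑² R (err G (labelling (map [_] R))) ≤ ∑² R (plus G)
∑²-err-singletons G R = ∑-mono-∈ R (λ {x} x∈R → ∑-mono-∈ R (λ {y} y∈R → go x∈R y∈R))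
  where
  ℓ = labelling (map [_] R)
  go : ∀ {x y} → x ∈ R → y ∈ R → err G ℓ x y ≤ plus G x y
  go {x} {y} x∈R y∈R = by-label (x Fin.≟ y) (ℓ x ≟ ℓ y)
    where
    by-label : (eq : Dec (x ≡ y)) (same : Dec (ℓ x ≡ ℓ y)) →
      (if does eq then 0 else if does same then 1 ∸ s G (x , y) else s G (x , y)) ≤
      (if does eq then 0 else s G (x , y))
    by-label (yes _)  _          = z≤n
    by-label (no x≢y) (yes same) = contradiction (labelling-singletons-injective R x∈R y∈R same) x≢y
    by-label (no _)   (no _)     = ≤-refl

-- Expectations of programs

splitResult : LabelledGraph n → Fin n → List (Fin n) → List (Fin n) × List (Fin n)
splitResult G v ws = filterᵇ (similar G v) ws , filterᵇ (not ∘ similar G v) ws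

splitResult-∷ : ∀ (G : LabelledGraph n) v w ws → let (N , rest) = splitResult G v ws in
  (if similar G v w then (w ∷ N , rest) else (N , w ∷ rest)) ≡ splitResult G v (w ∷ ws)
splitResult-∷ G v w ws with similar G v w
... | true  = refl
... | false = refl

𝔼->>= : ∀ (G : LabelledGraph n) (p : Prog n A) (k : A → Prog n B) f →
        𝔼 G (p >>= k) f ≡ 𝔼 G p (λ a → 𝔼 G (k a) f)
𝔼->>= G (return a)    k f = refl
𝔼->>= G (query x y p) k f = 𝔼->>= G (p (similar G x y)) k f
𝔼->>= G (uniform m p) k f =
  cong ((ℤ.+ 1 / m) ℚ.*_) (ℚSum.sum-cong-≗ (λ i → 𝔼->>= G (p i) k f))
𝔼->>= G (step p)      k f = 𝔼->>= G p k f

𝔼-steps : ∀ (G : LabelledGraph n) k (p : Prog n A) f → 𝔼 G (steps k p) f ≡ 𝔼 G p f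
𝔼-steps G zero    p f = refl
𝔼-steps G (suc k) p f = 𝔼-steps G k p f

𝔼-split : ∀ (G : LabelledGraph n) v ws f → 𝔼 G (split v ws) f ≡ f (splitResult G v ws)
𝔼-split G v []       f = refl
𝔼-split G v (w ∷ ws) f = trans (𝔼->>= G (split v ws) _ f)
  (trans (𝔼-split G v ws _) (cong f (splitResult-∷ G v w ws)))

𝔼-uniform-≤ : ∀ (G : LabelledGraph n) (xs : List A) .{{_ : NonZero (length xs)}}
  {k : Fin (length xs) → Prog n B} {f} (b : A → ℕ) {c} →
  (∀ i → 𝔼 G (k i) f ℚ.≤ fromℕ (b (lookup xs i))) → ∑ xs b ≤ length xs * c →
  𝔼 G (uniform (length xs) k) f ℚ.≤ fromℕ c
𝔼-uniform-≤ G xs {k} {f} b {c} 𝔼≤b ∑≤ = begin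
  (ℤ.+ 1 / m) ℚ.* ℚSum.sum (λ i → 𝔼 G (k i) f)
    ≤⟨ mono (ℚ.≤-trans (ℚsum-≤-∑ xs b 𝔼≤b) (fromℕ-mono ∑≤)) ⟩
  (ℤ.+ 1 / m) ℚ.* fromℕ (m * c)
    ≡⟨ cong ((ℤ.+ 1 / m) ℚ.*_) (fromℕ-* m c) ⟩
  (ℤ.+ 1 / m) ℚ.* (fromℕ m ℚ.* fromℕ c)
    ≡⟨ ℚ.*-assoc (ℤ.+ 1 / m) (fromℕ m) (fromℕ c) ⟨
  (ℤ.+ 1 / m) ℚ.* fromℕ m ℚ.* fromℕ c
    ≡⟨ cong (ℚ._* fromℕ c) (/-*-cancel 1 m) ⟩
  fromℕ 1 ℚ.* fromℕ c
    ≡⟨ trans (cong (ℚ._* fromℕ c) fromℕ-1) (ℚ.*-identityˡ (fromℕ c)) ⟩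
  fromℕ c ∎
  where
  open ℚ.≤-Reasoning
  m = length xs
  mono : ∀ {p q} → p ℚ.≤ q → (ℤ.+ 1 / m) ℚ.* p ℚ.≤ (ℤ.+ 1 / m) ℚ.* q
  mono = ℚ.*-monoˡ-≤-nonNeg (ℤ.+ 1 / m) {{ℚ.normalize-nonNeg 1 m}}

-- Brings the factor that clears denominators under the expectation, so that the loop can be bounded
-- in natural numbers.
𝔼-*ˡ : ∀ (G : LabelledGraph n) (p : Prog n A) c f →
       𝔼 G p (λ a → c ℚ.* f a) ≡ c ℚ.* 𝔼 G p f
𝔼-*ˡ G (return a)    c f = refl
𝔼-*ˡ G (query x y k) c f = 𝔼-*ˡ G (k (similar G x y)) c f
𝔼-*ˡ G (uniform m k) c f = begin
  1/m ℚ.* ℚSum.sum (λ i → 𝔼 G (k i) (λ a → c ℚ.* f a))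
    ≡⟨ cong (1/m ℚ.*_) (ℚSum.sum-cong-≗ (λ i → 𝔼-*ˡ G (k i) c f)) ⟩
  1/m ℚ.* ℚSum.sum (λ i → c ℚ.* 𝔼 G (k i) f)
    ≡⟨ cong (1/m ℚ.*_) (*-distribˡ-sum c (λ i → 𝔼 G (k i) f)) ⟨
  1/m ℚ.* (c ℚ.* 𝔼s)
    ≡⟨ trans (sym (ℚ.*-assoc 1/m c 𝔼s))
         (trans (cong (ℚ._* 𝔼s) (ℚ.*-comm 1/m c)) (ℚ.*-assoc c 1/m 𝔼s)) ⟩
  c ℚ.* (1/m ℚ.* 𝔼s) ∎
  where
  open ≡-Reasoning
  1/m = ℤ.+ 1 / m
  𝔼s = ℚSum.sum (λ i → 𝔼 G (k i) f)
𝔼-*ˡ G (step p)      c f = 𝔼-*ˡ G p c f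

-- Expected cost of the loop

-- With W(R) twice the number of "+" pairs inside R, each round takes W to at
-- most W − W²/n² on average, so after k rounds its mean is at most
-- W / (1 + k W / n²).  The terms after the first are, up to the factor
-- (i + k)², the tangent to this concave function of W at W = n²/i, which keeps
-- the induction hypothesis affine in W and hence compatible with averaging.
loopBound : LabelledGraph n → (Fin n → ℕ) → ℕ → ℕ → List (Fin n) → ℕ
loopBound {n} G ℓ i k R =
  (i + k) * (i + k) * (3 * ∑² R (err G ℓ)) + (i * i * ∑² R (plus G) + k * (n * n))

-- Joins the two potentials: `f` is for the cost of the round, `g` for the error of `ℓ` left over,
-- `h` for the "+" pairs left over, and `a` for what was paid before.
∑-affine-≤ : ∀ (R : List A) {f g h : A → ℕ} a c {C D} →
  ∑[ v ∈ R ] (f v + g v) ≤ length R * C → ∑[ v ∈ R ] h v ≤ length R * D →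
  ∑[ v ∈ R ] (a + c * f v + (c * g v + h v)) ≤ length R * (a + (c * C + D))
∑-affine-≤ R {f} {g} {h} a c {C} {D} fg≤C h≤D = begin
  ∑[ v ∈ R ] (a + c * f v + (c * g v + h v))
    ≡⟨ ∑-cong R (λ v → regroup a c (f v) (g v) (h v)) ⟩
  ∑[ v ∈ R ] (a + c * (f v + g v) + h v)
    ≡⟨ ∑-+ R (λ v → a + c * (f v + g v)) h ⟩
  ∑[ v ∈ R ] (a + c * (f v + g v)) + ∑ R h
    ≡⟨ cong (_+ ∑ R h) (trans (∑-+ R (λ _ → a) (λ v → c * (f v + g v)))
         (cong₂ _+_ (∑-const R a) (∑-*ˡ c R (λ v → f v + g v)))) ⟩
  length R * a + c * ∑[ v ∈ R ] (f v + g v) + ∑ R h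
    ≤⟨ +-mono-≤ (+-monoʳ-≤ (length R * a) (*-monoʳ-≤ c fg≤C)) h≤D ⟩
  length R * a + c * (length R * C) + length R * D
    ≡⟨ factor (length R) a c C D ⟩
  length R * (a + (c * C + D)) ∎
  where
  open ≤-Reasoning
  regroup : ∀ a c f g h → a + c * f + (c * g + h) ≡ a + c * (f + g) + h
  regroup = solve-∀
  factor : ∀ m a c C D → m * a + c * (m * C) + m * D ≡ m * (a + (c * C + D))
  factor = solve-∀

output-∷ : List (Fin n) → Output n → Output n
output-∷ C out = output (C ∷ clusters out) (singletons out)

residue : LabelledGraph n → (R : List (Fin n)) → Fin (length R) → List (Fin n)
residue G R i = filterᵇ (not ∘ similar G (lookup R i)) (removeAt R i)

length-residue : ∀ (G : LabelledGraph n) x R i → length (residue G (x ∷ R) i) ≤ length R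
length-residue G x R i = ≤-trans (length-filter _ (removeAt (x ∷ R) i))
  (≤-reflexive (length-removeAt (x ∷ R) i))

-- The additive constant a takes the cost of the clusters already emitted.
𝔼-loop-≤ : ∀ (G : LabelledGraph n) ℓ fuel Q R i k a {h} →
  length R ≤ fuel → length R ≤ n → Unique R → k * n ≤ Q →
  (∀ out → h out ℚ.≤
    fromℕ (a + (i + k) * (i + k) * ∑² R (err G (labelling (clustering out))))) →
  𝔼 G (loop fuel Q R) h ℚ.≤ fromℕ (a + loopBound G ℓ i k R)
𝔼-loop-≤ G ℓ zero Q [] i k a _ _ _ _ h≤ = ℚ.≤-trans (h≤ (output [] []))
  (fromℕ-mono (+-monoʳ-≤ a (≤-trans (≤-reflexive (*-zeroʳ ((i + k) * (i + k)))) z≤n)))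
𝔼-loop-≤ G ℓ (suc fuel) Q [] i k a _ _ _ _ h≤ = ℚ.≤-trans (h≤ (output [] []))
  (fromℕ-mono (+-monoʳ-≤ a (≤-trans (≤-reflexive (*-zeroʳ ((i + k) * (i + k)))) z≤n)))
𝔼-loop-≤ {n} G ℓ (suc fuel) Q R@(x ∷ xs) i k a {h} (s≤s m≤fuel) m≤n R! kn≤Q h≤ =
  by-budget (length xs ≤? Q)
  where
  survivors-≡ : ∀ j → residue G R j ≡ survivors G (lookup R j) R
  survivors-≡ j = filterᵇ-removeAt-survivors G R j R!

  cutErr : Fin n → ℕ
  cutErr v = ∑² R (pivotErr G v)

  pivotRound : Fin (length R) → Prog n (Output n)
  pivotRound j =
    steps (length R) (
    split (lookup R j) (removeAt R j) >>= λ (N , rest) →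
    step (
    loop fuel (Q ∸ length xs) rest >>= λ out →
    step (return (output-∷ (lookup R j ∷ N) out))))

  round : Prog n (Output n)
  round = uniform (length R) pivotRound

  -- The new parameters have the same sum, so the weight `c` of the cost is the same before and
  -- after the round; `Y` is the "+" part of the bound.
  round-≤ : ∀ i′ k′ (Y : ℕ) → i′ + k′ ≡ i + k → k′ * n ≤ Q ∸ length xs →
    ∑[ v ∈ R ] (i′ * i′ * ∑² (survivors G v R) (plus G) + k′ * (n * n)) ≤ length R * Y →
    𝔼 G round h ℚ.≤ fromℕ (a + ((i + k) * (i + k) * (3 * ∑² R (err G ℓ)) + Y))
  round-≤ i′ k′ Y i′k′ k′n≤ ∑≤Y =
    𝔼-uniform-≤ G R {k = pivotRound} {f = h}
      (λ v → a + c * cutErr v + (c * (3 * ∑² (survivors G v R) (err G ℓ))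
                               + (i′ * i′ * ∑² (survivors G v R) (plus G) + k′ * (n * n))))
      pivot-≤
      (∑-affine-≤ R a c (charging G ℓ R) ∑≤Y)
    where
    c = (i + k) * (i + k)

    pivot-≤ : ∀ j → let v = lookup R j in
      𝔼 G (pivotRound j) h ℚ.≤ fromℕ (a + c * cutErr v + (c * (3 * ∑² (survivors G v R) (err G ℓ))
                  + (i′ * i′ * ∑² (survivors G v R) (plus G) + k′ * (n * n))))
    pivot-≤ j = subst₂ ℚ._≤_
      (sym (trans (𝔼-steps G (length R) _ h)
           (trans (𝔼->>= G (split v (removeAt R j)) _ h)
           (trans (𝔼-split G v (removeAt R j) _)
                  (𝔼->>= G (loop fuel (Q ∸ length xs) (residue G R j)) _ h)))))
      (cong₂ (λ d rest → fromℕ (a + c * cutErr v + (d * d * (3 * ∑² rest (err G ℓ))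
                  + (i′ * i′ * ∑² rest (plus G) + k′ * (n * n))))) i′k′ (survivors-≡ j))
      (𝔼-loop-≤ G ℓ fuel (Q ∸ length xs) (residue G R j) i′ k′ (a + c * cutErr v)
        (≤-trans (length-residue G x xs j) m≤fuel)
        (≤-trans (length-residue G x xs j) (≤-trans (n≤1+n _) m≤n))
        (subst Unique (sym (survivors-≡ j)) (Unique.filter⁺ (T? ∘ not ∘ near G v) R!))
        k′n≤
        (λ out → ℚ.≤-trans (h≤ (output-∷ (pivotCluster G R j) out))
          (ℚ.≤-reflexive (cong fromℕ (cost-∷ out)))))
      where
      v = lookup R j

      -- The cost of the pivot's cluster moves into the additive constant of the recursive call.
      cost-∷ : ∀ out →
        a + c * ∑² R (err G (labelling (clustering (output-∷ (pivotCluster G R j) out)))) ≡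
        a + c * cutErr v +
          (i′ + k′) * (i′ + k′) * ∑² (residue G R j) (err G (labelling (clustering out)))
      cost-∷ out rewrite i′k′ | survivors-≡ j | ∑²-err-∷ G R j (clustering out) =
        distrib a c (cutErr v) _
        where
        distrib : ∀ a c e f → a + c * (e + f) ≡ a + c * e + c * f
        distrib = solve-∀

  by-budget : (b : Dec (length xs ≤ Q)) →
    𝔼 G (if does b then round else return (output [] R)) h ℚ.≤ fromℕ (a + loopBound G ℓ i k R)
  by-budget (yes _) = enough k kn≤Q refl
    where
    enough : ∀ k′ → k′ * n ≤ Q → k′ ≡ k →
             𝔼 G round h ℚ.≤ fromℕ (a + loopBound G ℓ i k R)
    -- The guaranteed rounds are over, but the budget allows one more: `i` stays, and it is enough
    -- that "+" pairs never increase.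
    enough zero    _   refl = round-≤ i 0 (i * i * ∑² R (plus G) + 0) refl z≤n
      (≤-trans (∑-mono R (λ v → +-monoˡ-≤ 0 (*-monoʳ-≤ (i * i) (survivors-plus-≤ G v R))))
               (≤-reflexive (∑-const R _)))
    -- A guaranteed round moves the tangent point on to n²/(i + 1) and spends at most n queries,
    -- which leaves enough for the other k′.
    enough (suc k′) kn refl = round-≤ (suc i) k′ (i * i * ∑² R (plus G) + suc k′ * (n * n))
      (sym (+-suc i k′))
      (≤-trans (≤-trans (≤-reflexive (sym (m+n∸m≡n n (k′ * n)))) (∸-monoˡ-≤ n kn))
               (∸-monoʳ-≤ Q (≤-trans (n≤1+n _) m≤n)))
      (plus-decay G i k′ n R m≤n)
  by-budget (no m≰Q) = exhausted k kn≤Q refl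
    where
    exhausted : ∀ k′ → k′ * n ≤ Q → k′ ≡ k → h (output [] R) ℚ.≤ fromℕ (a + loopBound G ℓ i k R)
    -- The leftover singletons cost at most W, and for k = 0 the weights (i + k)² and i² agree.
    exhausted zero     _  refl = ℚ.≤-trans (h≤ (output [] R)) (fromℕ-mono (+-monoʳ-≤ a (begin
      (i + 0) * (i + 0) * ∑² R (err G (labelling (map [_] R)))
        ≤⟨ *-monoʳ-≤ ((i + 0) * (i + 0)) (∑²-err-singletons G R) ⟩
      (i + 0) * (i + 0) * ∑² R (plus G)
        ≡⟨ drop-0 i (∑² R (plus G)) ⟩
      i * i * ∑² R (plus G) + 0
        ≤⟨ m≤n+m _ ((i + 0) * (i + 0) * (3 * ∑² R (err G ℓ))) ⟩
      loopBound G ℓ i 0 R ∎)))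
      where
      open ≤-Reasoning
      drop-0 : ∀ i w → (i + 0) * (i + 0) * w ≡ i * i * w + 0
      drop-0 = solve-∀
    -- With a round still guaranteed, the budget is at least n and the loop test cannot fail.
    exhausted (suc k′) kn refl = contradiction
      (≤-trans (≤-trans (n≤1+n _) m≤n) (≤-trans (m≤m+n n (k′ * n)) kn)) m≰Q


-- The number of guaranteed rounds and the bound on the cost

rounds : ∀ n Q → ∃[ k ] (k * n ≤ Q × n * Q ≤ n * (suc k * n))
-- For n = 0 and Q > 0 no k satisfies Q ≤ (k + 1) n; the extra factor n covers this case.
rounds zero      Q = 0 , z≤n , z≤n
rounds n@(suc _) Q = Q ℕ./ n , m/n*n≤m Q n ,
  *-monoʳ-≤ n (<⇒≤ (m<n+m%n))
  where
  m<n+m%n : Q < suc (Q ℕ./ n) * n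
  m<n+m%n = subst (_< suc (Q ℕ./ n) * n) (sym (m≡m%n+[m/n]*n Q n))
                  (+-monoˡ-< (Q ℕ./ n * n) (m%n<n Q n))

-- `slack` enters only through its product with 2Q, so no fraction needs to be normalised here.
QECC-cost-≤ : ∀ n (G : LabelledGraph n) Q .{{_ : NonZero Q}} slack →
  fromℕ (2 * Q) ℚ.* slack ≡ fromℕ (n ^ 3) →
  𝔼 G (QECC n Q) (λ out → fromℕ (cost G (labelling (clustering out)))) ℚ.≤
  fromℕ (3 * OPT G) ℚ.+ slack
QECC-cost-≤ n G Q slack 2Q*slack≡n³ with rounds n Q | proj₁ (proj₂ (minimumCost G))
... | k , kn≤Q , nQ≤n[1+k]n | ℓ , ℓ-optimal =
  -- The multiplier: `c` is the weight (1 + k)² of the loop bound, 2 passes to ordered pairs, and Q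
  -- clears the denominator of `slack`.
  ℚ.*-cancelˡ-≤-pos (fromℕ (c * (2 * Q)))
    {{fromℕ-pos (c * (2 * Q)) {{m*n≢0 c (2 * Q) {{_}} {{m*n≢0 2 Q}}}}}} (begin
  fromℕ (c * (2 * Q)) ℚ.* 𝔼 G (QECC n Q) (fromℕ ∘ value)
    ≡⟨ cong (λ a → fromℕ a ℚ.* 𝔼 G (QECC n Q) (fromℕ ∘ value)) (shuffle c Q) ⟩
  fromℕ (Q * (c * 2)) ℚ.* 𝔼 G (QECC n Q) (fromℕ ∘ value)
    ≡⟨ trans (cong (ℚ._* 𝔼 G (QECC n Q) (fromℕ ∘ value)) (fromℕ-* Q (c * 2)))
             (ℚ.*-assoc (fromℕ Q) (fromℕ (c * 2)) _) ⟩
  fromℕ Q ℚ.* (fromℕ (c * 2) ℚ.* 𝔼 G (QECC n Q) (fromℕ ∘ value))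
    ≡⟨ cong (fromℕ Q ℚ.*_) (𝔼-*ˡ G (QECC n Q) (fromℕ (c * 2)) (fromℕ ∘ value)) ⟨
  fromℕ Q ℚ.* 𝔼 G (QECC n Q) (λ out → fromℕ (c * 2) ℚ.* fromℕ (value out))
    ≤⟨ ℚ.*-monoˡ-≤-nonNeg (fromℕ Q) {{fromℕ-nonNeg Q}} loop-≤ ⟩
  fromℕ Q ℚ.* fromℕ (loopBound G ℓ 1 k V)
    ≡⟨ fromℕ-* Q (loopBound G ℓ 1 k V) ⟨
  fromℕ (Q * loopBound G ℓ 1 k V)
    ≤⟨ fromℕ-mono bound-≤ ⟩
  fromℕ (c * (2 * Q) * (3 * OPT G) + c * n ^ 3)
    ≡⟨ trans (fromℕ-+ (c * (2 * Q) * (3 * OPT G)) (c * n ^ 3))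
             (cong₂ ℚ._+_ (fromℕ-* (c * (2 * Q)) (3 * OPT G)) (sym unscale)) ⟩
  fromℕ (c * (2 * Q)) ℚ.* fromℕ (3 * OPT G) ℚ.+ fromℕ (c * (2 * Q)) ℚ.* slack
    ≡⟨ ℚ.*-distribˡ-+ (fromℕ (c * (2 * Q))) (fromℕ (3 * OPT G)) slack ⟨
  fromℕ (c * (2 * Q)) ℚ.* (fromℕ (3 * OPT G) ℚ.+ slack) ∎)
  where
  open ℚ.≤-Reasoning
  V = allFin n
  c = suc k * suc k
  value : Output n → ℕ
  value out = cost G (labelling (clustering out))

  shuffle : ∀ c Q → c * (2 * Q) ≡ Q * (c * 2)
  shuffle = solve-∀

  |V|≡n : length V ≡ n
  |V|≡n = length-tabulate (λ i → i)

  unscale : fromℕ (c * (2 * Q)) ℚ.* slack ≡ fromℕ (c * n ^ 3)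
  unscale = trans (cong (ℚ._* slack) (fromℕ-* c (2 * Q)))
    (trans (ℚ.*-assoc (fromℕ c) (fromℕ (2 * Q)) slack)
    (trans (cong (fromℕ c ℚ.*_) 2Q*slack≡n³) (sym (fromℕ-* c (n ^ 3)))))

  loop-≤ : 𝔼 G (QECC n Q) (λ out → fromℕ (c * 2) ℚ.* fromℕ (value out)) ℚ.≤
           fromℕ (loopBound G ℓ 1 k V)
  -- `i` = 1 is the tangent at W = n², an upper bound for the initial W; nothing has been paid yet,
  -- so `a` = 0.
  loop-≤ = 𝔼-loop-≤ G ℓ n Q V 1 k 0
    (≤-reflexive |V|≡n) (≤-reflexive |V|≡n) (Unique.allFin⁺ n) kn≤Q
    (λ out → ℚ.≤-reflexive (trans (sym (fromℕ-* (c * 2) (value out)))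
      (cong fromℕ (trans (*-assoc c 2 (value out))
                         (cong (c *_) (cost-double G (labelling (clustering out))))))))

  plus-≤ : ∑² V (plus G) ≤ n * n
  plus-≤ = ≤-trans (∑²-mono V plus≤1) (≤-reflexive
    (trans (∑-cong V (λ _ → ∑-const V 1)) (trans (∑-const V (length V * 1))
      (cong₂ _*_ |V|≡n (trans (*-identityʳ _) |V|≡n)))))
    where
    plus≤1 : ∀ x y → plus G x y ≤ 1
    plus≤1 x y with does (x Fin.≟ y) | similar G x y
    ... | true  | _     = z≤n
    ... | false | true  = ≤-refl
    ... | false | false = z≤n

  bound-≤ : Q * loopBound G ℓ 1 k V ≤ c * (2 * Q) * (3 * OPT G) + c * n ^ 3
  bound-≤ = ≤-trans
    (*-monoʳ-≤ Q (+-mono-≤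
      (≤-reflexive (cong (λ t → c * (3 * t))
        (trans (sym (cost-double G ℓ)) (cong (2 *_) ℓ-optimal))))
      (+-monoˡ-≤ (k * (n * n)) (≤-trans (≤-reflexive (*-identityˡ _)) plus-≤))))
    -- Q (n² + k n²) = (k + 1) n (n Q), and the choice of k bounds n Q by (k + 1) n², which gives c
    -- n³.
    (≤-trans (≤-reflexive (expand Q c (OPT G) n k))
    (≤-trans (+-monoʳ-≤ (c * (2 * Q) * (3 * OPT G)) (*-monoʳ-≤ (suc k * n) nQ≤n[1+k]n))
             (≤-reflexive (cong (c * (2 * Q) * (3 * OPT G) +_) (cube k n)))))
    where
    expand : ∀ Q c o n k → Q * (c * (3 * (2 * o)) + (n * n + k * (n * n))) ≡
                           c * (2 * Q) * (3 * o) + (1 + k) * n * (n * Q)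
    expand = solve-∀
    cube : ∀ k n → (1 + k) * n * (n * ((1 + k) * n)) ≡ (1 + k) * (1 + k) * (n * (n * (n * 1)))
    cube = solve-∀

opaque
  unfolding fromℕ

  -- `fromℕ` is unfolded here to reach the explicit fractions of the theorem.
  QECC-cost : ∀ n (G : LabelledGraph n) Q .{{_ : NonZero Q}} →
    𝔼 G (QECC n Q) (λ out → ℤ.+ cost G (labelling (clustering out)) / 1) ℚ.≤
    (ℤ.+ (3 * OPT G) / 1) ℚ.+ _/_ (ℤ.+ (n ^ 3)) (2 * Q) {{m*n≢0 2 Q}}
  QECC-cost n G Q = QECC-cost-≤ n G Q slack
    (trans (ℚ.*-comm (fromℕ (2 * Q)) slack) (/-*-cancel (n ^ 3) (2 * Q) {{m*n≢0 2 Q}}))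
    where
    slack : ℚ
    slack = _/_ (ℤ.+ (n ^ 3)) (2 * Q) {{m*n≢0 2 Q}}

-- Inversion of runs

Run->>=⁻ : ∀ {G : LabelledGraph n} (p : Prog n A) {k : A → Prog n B} {b q t} →
  Run G (p >>= k) b q t →
  ∃[ a ] ∃[ q₁ ] ∃[ t₁ ] ∃[ q₂ ] ∃[ t₂ ]
    Run G p a q₁ t₁ × Run G (k a) b q₂ t₂ × q ≡ q₁ + q₂ × t ≡ t₁ + t₂
Run->>=⁻ (return a)    r = a , 0 , 0 , _ , _ , return , r , refl , refl
Run->>=⁻ {G = G} (query x y p) (query r) with Run->>=⁻ (p (similar G x y)) r
... | a , _ , _ , _ , _ , r₁ , r₂ , refl , refl =
  a , _ , _ , _ , _ , query r₁ , r₂ , refl , refl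
Run->>=⁻ (uniform m {{m≢0}} p) (uniform {{_}} i r) with Run->>=⁻ (p i) r
... | a , _ , _ , _ , _ , r₁ , r₂ , refl , refl =
  a , _ , _ , _ , _ , uniform {{m≢0}} i r₁ , r₂ , refl , refl
Run->>=⁻ (step p)      (step r) with Run->>=⁻ p r
... | a , _ , _ , _ , _ , r₁ , r₂ , refl , refl =
  a , _ , _ , _ , _ , step r₁ , r₂ , refl , refl

Run-steps⁻ : ∀ {G : LabelledGraph n} k {p : Prog n A} {a q t} →
  Run G (steps k p) a q t → ∃[ t′ ] Run G p a q t′ × t ≡ k + t′
Run-steps⁻ zero    r = _ , r , refl
Run-steps⁻ (suc k) (step r) with Run-steps⁻ k r
... | _ , r′ , refl = _ , r′ , refl

Run-split⁻ : ∀ (G : LabelledGraph n) v ws {a q t} → Run G (split v ws) a q t →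
  a ≡ splitResult G v ws × q ≡ length ws × t ≡ 2 * length ws
Run-split⁻ G v []       return = refl , refl , refl
Run-split⁻ G v (w ∷ ws) (query (step r)) with Run->>=⁻ (split v ws) r
... | _ , _ , _ , _ , _ , r₁ , return , refl , refl with Run-split⁻ G v ws r₁
...   | refl , refl , refl =
  splitResult-∷ G v w ws , cong suc (+-identityʳ _) , two (length ws)
  where
  two : ∀ a → suc (suc (2 * a + 0)) ≡ 2 * suc a
  two = solve-∀

record Round {n} (G : LabelledGraph n) fuel Q x (xs : List (Fin n)) out q t : Set where
  constructor mkRound
  field
    affordable : length xs ≤ Q
    pivot      : Fin (length (x ∷ xs))
    {out′}     : Output n
    {q′ t′}    : ℕ
    run        : Run G (loop fuel (Q ∸ length xs) (residue G (x ∷ xs) pivot)) out′ q′ t′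
    out≡       : out ≡ output-∷ (pivotCluster G (x ∷ xs) pivot) out′
    q≡         : q ≡ length xs + q′
    -- With m = `length xs`: one step each for the test, the draw, the budget and the output, m + 1
    -- for removing the pivot, 2m for `split`.
    t≡         : t ≡ 3 * length xs + 5 + t′

-- The claims on partition, nonemptiness, queries and time all recurse on this one inversion of a
-- round.
Run-loop⁻ : ∀ (G : LabelledGraph n) fuel Q x xs {out q t} →
  Run G (loop (suc fuel) Q (x ∷ xs)) out q t →
  (out ≡ output [] (x ∷ xs) × q ≡ 0 × t ≡ 1) ⊎ Round G fuel Q x xs out q t
Run-loop⁻ {n} G fuel Q x xs {out} (step {t = t} r) = by-budget (length xs ≤? Q) r
  where
  R = x ∷ xs

  pivotRound : Fin (length R) → Prog n (Output n)
  pivotRound j =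
    steps (length R) (
    split (lookup R j) (removeAt R j) >>= λ (N , rest) →
    step (
    loop fuel (Q ∸ length xs) rest >>= λ out →
    step (return (output-∷ (lookup R j ∷ N) out))))

  by-budget : ∀ (b : Dec (length xs ≤ Q)) {out q t} →
    Run G (if does b then uniform (length R) pivotRound else return (output [] R)) out q t →
    (out ≡ output [] R × q ≡ 0 × suc t ≡ 1) ⊎ Round G fuel Q x xs out q (suc t)
  by-budget (no _)    return = inj₁ (refl , refl , refl)
  by-budget (yes m≤Q) (uniform i r) with Run-steps⁻ (length R) r
  ... | _ , r₁ , refl with Run->>=⁻ (split (lookup R i) (removeAt R i)) r₁
  ... | _ , _ , _ , _ , _ , rs , step r₂ , refl , refl
    with Run-split⁻ G (lookup R i) (removeAt R i) rs
  ... | refl , refl , refl with Run->>=⁻ (loop fuel (Q ∸ length xs) (residue G R i)) r₂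
  ... | out′ , q′ , t′ , _ , _ , r₃ , step return , refl , refl
    rewrite length-removeAt R i =
    inj₂ (mkRound m≤Q i r₃ refl (cong (length xs +_) (+-identityʳ q′)) (total (length xs) t′))
    where
    total : ∀ m t → 2 + (1 + m + (2 * m + (1 + (t + 1)))) ≡ 3 * m + 5 + t
    total = solve-∀

-- Output, queries and time of a run

loop-partition : ∀ (G : LabelledGraph n) fuel Q R {out q t} → Run G (loop fuel Q R) out q t →
  concat (clustering out) ↭ R
loop-partition G zero       Q R  return        = ↭-reflexive (concat-map-[_] R)
loop-partition G (suc fuel) Q [] (step return) = ↭-refl
loop-partition G (suc fuel) Q R@(x ∷ xs) r with Run-loop⁻ G fuel Q x xs r
... | inj₁ (refl , _) = ↭-reflexive (concat-map-[_] R)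
... | inj₂ (mkRound _ i r′ refl _ _) =
  -- The later clusters permute the residue, which together with `N` makes up `removeAt R i`; then
  -- the pivot returns to its position.
  ↭-trans (prep _ (++⁺ˡ N (loop-partition G fuel _ (residue G R i) r′)))
  (↭-trans (prep _ (filterᵇ-++-↭ (similar G (lookup R i)) (removeAt R i))) (removeAt-↭ R i))
  where N = filterᵇ (similar G (lookup R i)) (removeAt R i)

singletons-nonEmpty : ∀ (R : List A) → All (_≢ []) (map [_] R)
singletons-nonEmpty []      = []
singletons-nonEmpty (x ∷ R) = (λ ()) ∷ singletons-nonEmpty R

loop-nonEmpty : ∀ (G : LabelledGraph n) fuel Q R {out q t} → Run G (loop fuel Q R) out q t →
  All (_≢ []) (clustering out)
loop-nonEmpty G zero       Q R  return        = singletons-nonEmpty R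
loop-nonEmpty G (suc fuel) Q [] (step return) = []
loop-nonEmpty G (suc fuel) Q (x ∷ xs) r with Run-loop⁻ G fuel Q x xs r
... | inj₁ (refl , _) = singletons-nonEmpty (x ∷ xs)
... | inj₂ (mkRound _ _ r′ refl _ _) = (λ ()) ∷ loop-nonEmpty G fuel _ _ r′

-- A round takes place only if its queries fit into the budget, so the subtraction is not truncated
-- and spent plus remaining gives Q.
loop-queries : ∀ (G : LabelledGraph n) fuel Q R {out q t} → Run G (loop fuel Q R) out q t → q ≤ Q
loop-queries G zero       Q R  return        = z≤n
loop-queries G (suc fuel) Q [] (step return) = z≤n
loop-queries G (suc fuel) Q (x ∷ xs) r with Run-loop⁻ G fuel Q x xs r
... | inj₁ (_ , refl , _) = z≤n
... | inj₂ (mkRound m≤Q _ r′ _ refl _) =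
  ≤-trans (+-monoʳ-≤ (length xs) (loop-queries G fuel _ _ r′)) (≤-reflexive (m+[n∸m]≡n m≤Q))

loop-[]-time : ∀ (G : LabelledGraph n) fuel Q {out q t} → Run G (loop fuel Q []) out q t → t ≤ 1
loop-[]-time G zero       Q return        = z≤n
loop-[]-time G (suc fuel) Q (step return) = ≤-refl

-- A round with |R| = m + 1 takes 3 m + 5 steps for m queries.  The additive
-- constant pays for a round with m = 0, which can only be the last one.
loop-time : ∀ (G : LabelledGraph n) fuel Q R {out q t} → Run G (loop fuel Q R) out q t →
  t ≤ 8 * Q + 6
loop-time G zero       Q R  return        = z≤n
loop-time G (suc fuel) Q [] (step return) = ≤-trans (s≤s z≤n) (m≤n+m 6 (8 * Q))
loop-time G (suc fuel) Q (x ∷ xs) r with Run-loop⁻ G fuel Q x xs r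
loop-time G (suc fuel) Q (x ∷ xs) r | inj₁ (_ , _ , refl) = ≤-trans (s≤s z≤n) (m≤n+m 6 (8 * Q))
-- The 6 arises here: five steps for the round and at most one for the loop on the empty residue.
loop-time G (suc fuel) Q (x ∷ []) r | inj₂ (mkRound _ zero r′ _ _ refl) =
  ≤-trans (+-monoʳ-≤ 5 (loop-[]-time G fuel Q r′)) (m≤n+m 6 (8 * Q))
loop-time G (suc fuel) Q (x ∷ xs@(_ ∷ ys)) r | inj₂ (mkRound m≤Q _ {t′ = t′} r′ _ _ refl) = begin
  3 * m + 5 + t′                 ≤⟨ +-monoʳ-≤ (3 * m + 5) (loop-time G fuel _ _ r′) ⟩
  3 * m + 5 + (8 * (Q ∸ m) + 6)  ≤⟨ +-monoˡ-≤ (8 * (Q ∸ m) + 6) 3m+5≤8m ⟩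
  8 * m + (8 * (Q ∸ m) + 6)      ≡⟨ regroup m (Q ∸ m) ⟩
  8 * (m + (Q ∸ m)) + 6          ≡⟨ cong (λ a → 8 * a + 6) (m+[n∸m]≡n m≤Q) ⟩
  8 * Q + 6                      ∎
  where
  open ≤-Reasoning
  m = length xs
  regroup : ∀ m d → 8 * m + (8 * d + 6) ≡ 8 * (m + d) + 6
  regroup = solve-∀
  split-8 : ∀ a → 3 * suc a + 5 + 5 * a ≡ 8 * suc a
  split-8 = solve-∀
  3m+5≤8m : 3 * m + 5 ≤ 8 * m
  -- Rests on m ≥ 1, as m is the successor of `length ys`.
  3m+5≤8m = m+n≤o⇒m≤o (3 * m + 5) (≤-reflexive (split-8 (length ys)))

-- Since Q ≥ 1, the additive 6 is at most 6Q, and 8 + 6 = 14.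
QECC-time : ∀ n (G : LabelledGraph n) Q .{{_ : NonZero Q}} {out q t} →
  Run G (QECC n Q) out q t → t ≤ 14 * Q
QECC-time n G Q@(suc Q-1) r = ≤-trans (loop-time G n Q (allFin n) r)
  (m+n≤o⇒m≤o (8 * Q + 6) (≤-reflexive (absorb Q-1)))
  where
  absorb : ∀ a → 8 * suc a + 6 + 6 * a ≡ 14 * suc a
  absorb = solve-∀

QECC-clustering : ∀ n (G : LabelledGraph n) Q {out q t} →
  Run G (QECC n Q) out q t → IsClustering (clustering out)
QECC-clustering n G Q r = record
  { nonEmpty  = loop-nonEmpty G n Q (allFin n) r
  ; partition = loop-partition G n Q (allFin n) r
  }

open import Data.Integer.Base using (+_)

theorem3p1 : (∀ n (G : LabelledGraph n) (Q : ℕ) .{{_ : NonZero Q}} →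
    (∀ {out q t} → Run G (QECC n Q) out q t → q ≤ Q × IsClustering (clustering out))
    × 𝔼 G (QECC n Q) (λ out → + cost G (labelling (clustering out)) / 1)
    ℚ.≤ (+ (3 * OPT G) / 1) ℚ.+ _/_ (+ (n ^ 3)) (2 * Q) {{m*n≢0 2 Q}})
    ×
    (∃[ c ] (∀ n (G : LabelledGraph n) (Q : ℕ) .{{_ : NonZero Q}} {out q t} →
    Run G (QECC n Q) out q t → t ≤ c * Q))
theorem3p1 =
  (λ n G Q → (λ r → loop-queries G n Q (allFin n) r , QECC-clustering n G Q r) , QECC-cost n G Q) ,
  14 , λ n G Q r → QECC-time n G Q r
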